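{- Let $d\ge1$ be an integer, $P\subseteq\mathbb R\times[d]$, and consider the convexity space $(P,\mathcal C_{\equiv}(P))$ described in the context. Then: (1) $r(P,\mathcal C_{\equiv}(P))\le 2d+1$; moreover, if $P$ contains at least $2$ points in every level, then $r(P,\mathcal C_{\equiv}(P))=2d+1$. (2) $h(P,\mathcal C_{\equiv}(P))\le 2d$; moreover, if $P$ contains at least $2$ points in every level, then $h(P,\mathcal C_{\equiv}(P))=2d$. (3) $h_c(P,\mathcal C_{\equiv}(P))\le 2d$; moreover, if $P$ contains at least $2$ points in every level, then $h_c(P,\mathcal C_{\equiv}(P))=2d$. (4) $h_f(P,\mathcal C_{\equiv}(P))=2$. (5) $(P,\mathcal C_{\equiv}(P))$ admits a $(p,q)$ theorem for all integers $p\ge q\ge2$. (6) $(P,\mathcal C_{\equiv}(P))$ admits the first kind of colorful $(p,q)$ theorem for all integers $p\ge q\ge 2$. (7) $(P,\mathcal C_{\equiv}(P))$ admits the second kind of colorful $(p,q)$ theorem for all integers $p\ge q\ge 2$.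
   Context: $[n]=\{1,\dots,n\}$. A (separated) $d$-interval is a set $I=\bigcup_{i\in[d]}\{(x,i): x\in I^{(i)}\}\subseteq\mathbb R\times[d]$ with each $I^{(i)}\subseteq\mathbb R$ convex (possibly empty); points $(x,i)$ are said to lie in the $i$-th level. For $P\subseteq\mathbb R\times[d]$, $\mathcal C_{\equiv}(P)=\{I\cap P: I \text{ a } d\text{ -interval}\}$; $(P,\mathcal C_{\equiv}(P))$ is a convexity space. For a convexity space $(X,\mathcal C)$ (a family $\mathcal C$ of subsets of $X$ containing $\emptyset$ and $X$, closed under arbitrary nonempty intersections and unions of nonempty chains), $\mathrm{conv}\,Y=\bigcap\{K\in\mathcal C: Y\subseteq K\}$; a family of sets "intersects" if the intersection of all its members is nonempty. Radon number $r(X,\mathcal C)$: the minimal $n$ such that every $Y\subseteq X$ with $|Y|\ge n$ has a partition $Y=A\cup B$ with $\mathrm{conv}A\cap\mathrm{conv}B\ne\emptyset$. Helly number $h(X,\mathcal C)$: the minimal $n$ such that for every finite $\mathcal F\subseteq\mathcal C$, if every at most $n$ members of $\mathcal F$ intersect then all members of $\mathcal F$ intersect. Colorful Helly number $h_c(X,\mathcal C)$: the minimal $n$ such that for any finite $\mathcal F_1,\dots,\mathcal F_n\subseteq\mathcal C$, if $\bigcap_{i=1}^n C_i\ne\emptyset$ for all choices $C_i\in\mathcal F_i$, then some $\mathcal F_i$ has nonempty intersection. Fractional Helly number $h_f(X,\mathcal C)$: the minimal $k$ such that there is a function $\beta:(0,1)\to(0,1)$ with the property that every finite $\mathcal F\subseteq\mathcal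 C$ having at least $\alpha\binom{|\mathcal F|}{k}$ intersecting $k$-element subfamilies contains an intersecting subfamily of size at least $\beta(\alpha)|\mathcal F|$. $(p,q)$ theorem: there is $N=N(p,q)$ such that every finite $\mathcal F\subseteq\mathcal C$ in which among any $p$ members some $q$ intersect admits a set $S\subseteq X$, $|S|\le N$, meeting every member of $\mathcal F$. First kind of colorful $(p,q)$ theorem: there is $N_c=N_c(p,q)$ such that for all finite $\mathcal F_1,\dots,\mathcal F_q\subseteq\mathcal C$ with the property that whenever for each $i\in[q]$ distinct sets $C_{i,1},\dots,C_{i,p}\in\mathcal F_i$ are chosen there are $j_1,\dots,j_q\in[p]$ with $\bigcap_{i=1}^q C_{i,j_i}\ne\emptyset$, there exist $S\subseteq X$ with $|S|\le N_c$ and $i\in[q]$ such that every member of $\mathcal F_i$ meets $S$. Second kind of colorful $(p,q)$ theorem: there is $M_c=M_c(p,q)$ such that for all finite $\mathcal F_1,\dots,\mathcal F_p\subseteq\mathcal C$ with the property that for every choice $C_i\in\mathcal F_i$ ($i\in[p]$) some $q$ of the $C_i$ have a common point, there exist $S\subseteq X$ with $|S|\le M_c$ and $i\in[p]$ such that every member of $\mathcal F_i$ meets $S$.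
   Formalization: In (4) families must have at least k members, and h_f = 2 is asserted only for infinite P (for finite P h_f is at most 1; the fractional Helly property for k = 2 is proved for every P); in (5) and (6) all members of the families are assumed nonempty, since {∅} is a counterexample. -}

module Defs where

open import Algebra.Bundles.Raw using (RawMonoid)
import Algebra.Definitions.RawMonoid as RawMonoidDefinitions
open import Data.Fin.Base using (Fin)
open import Data.Fin.Subset using (Subset; ⊤; ∣_∣) renaming (_∈_ to _∈ˢ_; _⊆_ to _⊆ˢ_)
open import Data.Integer.Base using (+_)
open import Data.List.Base using (List; length)
open import Data.List.Relation.Unary.All using (All)
open import Data.List.Relation.Unary.Any using (Any)
open import Data.List.Relation.Unary.Unique.Propositional using (Unique)
open import Data.Nat.Base as ℕ using (ℕ)
open import Data.Nat.Combinatorics using (_C_)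
open import Data.Product.Base using (Σ-syntax; ∃; ∃₂; ∃-syntax; _×_; _,_; proj₁; proj₂; swap)
open import Data.Product.Relation.Binary.Pointwise.NonDependent using (×-setoid)
open import Data.Rational.Base as ℚ using (ℚ; 1ℚ)
import Data.Rational.Properties as ℚ
open import Function.Bundles using (Func)
open import Function.Definitions using (Injective)
open import Level using (Level; 0ℓ; _⊔_) renaming (suc to lsuc)
open import Relation.Binary.Bundles using (Setoid)
open import Relation.Binary.Definitions using (_Respects_; tri<; tri≈; tri>)
import Relation.Binary.Construct.On as On
open import Relation.Binary.PropositionalEquality using (_≡_; refl; sym; trans; cong; subst; setoid)
open import Relation.Nullary.Negation using (¬_; contradiction)
open import Relation.Unary using (Pred; _∈_; _∉_; _⊆_; _≐_; _∪_; _∩_; _⊥_; _≬_; Satisfiable)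

------------------------------------------------------------------------
-- Real numbers as Dedekind cuts

-- Only the lower half of the cut is recorded; classically the upper half is
-- its complement.
record ℝ : Set₁ where
  field
    lower     : Pred ℚ 0ℓ
    inhabited : ∃ λ q → q ∈ lower
    bounded   : ∃ λ q → q ∉ lower
    closed    : ∀ {q r} → r ℚ.< q → q ∈ lower → r ∈ lower
    rounded   : ∀ {q} → q ∈ lower → ∃ λ r → q ℚ.< r × r ∈ lower

open ℝ

infix 4 _≤_ _<_ _≈_

_≤_ : ℝ → ℝ → Set
x ≤ y = lower x ⊆ lower y

_<_ : ℝ → ℝ → Set
x < y = ∃ λ q → q ∈ lower y × q ∉ lower x

_≈_ : ℝ → ℝ → Set
x ≈ y = x ≤ y × y ≤ x

ℝ-setoid : Setoid (lsuc 0ℓ) 0ℓ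
ℝ-setoid = record
  { Carrier       = ℝ
  ; _≈_           = _≈_
  ; isEquivalence = record
    { refl  = (λ p → p) , (λ p → p)
    ; sym   = swap
    ; trans = λ (a , b) (c , d) → (λ p → c (a p)) , (λ p → b (d p))
    }
  }

private
  p-1<p : ∀ p → p ℚ.- 1ℚ ℚ.< p
  p-1<p p = subst (p ℚ.- 1ℚ ℚ.<_) (ℚ.+-identityʳ p)
    (ℚ.+-monoʳ-< p (ℚ.negative⁻¹ (ℚ.- 1ℚ)))

  p<p+1 : ∀ p → p ℚ.< p ℚ.+ 1ℚ
  p<p+1 p = subst (ℚ._< p ℚ.+ 1ℚ) (ℚ.+-identityʳ p)
    (ℚ.+-monoʳ-< p (ℚ.positive⁻¹ 1ℚ))

  [p-q]+q≡p : ∀ p q → (p ℚ.- q) ℚ.+ q ≡ p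
  [p-q]+q≡p p q = trans (ℚ.+-assoc p (ℚ.- q) q)
    (trans (cong (p ℚ.+_) (ℚ.+-inverseˡ q)) (ℚ.+-identityʳ p))

  [p+q]-q≡p : ∀ p q → (p ℚ.+ q) ℚ.- q ≡ p
  [p+q]-q≡p p q = trans (ℚ.+-assoc p q (ℚ.- q))
    (trans (cong (p ℚ.+_) (ℚ.+-inverseʳ q)) (ℚ.+-identityʳ p))

  lower<upper : ∀ x {q r} → q ∈ lower x → r ∉ lower x → q ℚ.< r
  lower<upper x {q} {r} q∈ r∉ with ℚ.<-cmp q r
  ... | tri< q<r _ _  = q<r
  ... | tri≈ _ refl _ = contradiction q∈ r∉
  ... | tri> _ _ r<q  = contradiction (closed x r<q q∈) r∉

fromℚ : ℚ → ℝ
fromℚ p = record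
  { lower     = ℚ._< p
  ; inhabited = p ℚ.- 1ℚ , p-1<p p
  ; bounded   = p , ℚ.<-irrefl refl
  ; closed    = ℚ.<-trans
  ; rounded   = ℚ.<-dense
  }

fromℕ : ℕ → ℝ
fromℕ n = fromℚ (+ n ℚ./ 1)

infixl 6 _+_

_+_ : ℝ → ℝ → ℝ
x + y = record
  { lower     = λ q → ∃₂ λ r s → r ∈ lower x × s ∈ lower y × q ≡ r ℚ.+ s
  ; inhabited = let r , r∈ = inhabited x; s , s∈ = inhabited y in
                r ℚ.+ s , r , s , r∈ , s∈ , refl
  ; bounded   = let b , b∉ = bounded x; c , c∉ = bounded y in
                b ℚ.+ c , λ (r , s , r∈ , s∈ , eq) →
                  ℚ.<-irrefl (sym eq)
                    (ℚ.+-mono-< (lower<upper x r∈ b∉) (lower<upper y s∈ c∉))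
  ; closed    = λ { {_} {p} p<q (r , s , r∈ , s∈ , refl) →
                  p ℚ.- s , s
                  , closed x (subst (p ℚ.- s ℚ.<_) ([p+q]-q≡p r s)
                                (ℚ.+-monoˡ-< (ℚ.- s) p<q)) r∈
                  , s∈ , sym ([p-q]+q≡p p s) }
  ; rounded   = λ { (r , s , r∈ , s∈ , refl) →
                  let t , r<t , t∈ = rounded x r∈ in
                  t ℚ.+ s , ℚ.+-monoˡ-< s r<t , t , s , t∈ , s∈ , refl }
  }

+-rawMonoid : RawMonoid (lsuc 0ℓ) 0ℓ
+-rawMonoid = record { Carrier = ℝ ; _≈_ = _≈_ ; _∙_ = _+_ ; ε = fromℕ 0 }

open RawMonoidDefinitions +-rawMonoid public using () renaming (_×_ to _·_)

-- The open unit interval (0,1).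
UnitInterval : Setoid (lsuc 0ℓ) 0ℓ
UnitInterval = On.setoid {B = Σ[ x ∈ ℝ ] fromℕ 0 < x × x < fromℕ 1} ℝ-setoid proj₁

------------------------------------------------------------------------
-- Subsets of a setoid

record 𝒫 {c ℓ} (S : Setoid c ℓ) : Set (c ⊔ ℓ ⊔ lsuc 0ℓ) where
  open Setoid S using (Carrier) renaming (_≈_ to _∼_)
  field
    ⟦_⟧  : Pred Carrier 0ℓ
    resp : ⟦_⟧ Respects _∼_

open 𝒫 public using (⟦_⟧)

------------------------------------------------------------------------
-- Numerical parameters, given as least elements of sets of naturals

IsLeast : ∀ {ℓ} → Pred ℕ ℓ → Pred ℕ ℓ
IsLeast Q n = Q n × (∀ m → Q m → n ℕ.≤ m)

LeastAtMost : ∀ {ℓ} → Pred ℕ ℓ → Pred ℕ ℓ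
LeastAtMost Q b = ∃[ n ] IsLeast Q n × n ℕ.≤ b

------------------------------------------------------------------------
-- Invariants of a set X equipped with a family 𝒞 of its subsets

module Convexity {c ℓ k : Level} (S : Setoid c ℓ) (X : 𝒫 S) (𝒞 : Pred (𝒫 S) k) where

  open Setoid S using (Carrier) renaming (_≈_ to _∼_)

  conv : 𝒫 S → Pred Carrier (c ⊔ ℓ ⊔ k ⊔ lsuc 0ℓ)
  conv Y x = ∀ K → K ∈ 𝒞 → ⟦ Y ⟧ ⊆ ⟦ K ⟧ → x ∈ ⟦ K ⟧

  -- |Y| ≥ n, where Y may be infinite.
  HasAtLeast : ℕ → 𝒫 S → Set (c ⊔ ℓ)
  HasAtLeast n Y =
    Σ[ f ∈ (Fin n → Carrier) ] (∀ i → f i ∈ ⟦ Y ⟧) × Injective _≡_ _∼_ f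

  Infinite : 𝒫 S → Set (c ⊔ ℓ)
  Infinite Y = ∀ n → HasAtLeast n Y

  RadonProperty : ℕ → Set (c ⊔ ℓ ⊔ k ⊔ lsuc 0ℓ)
  RadonProperty n =
    ∀ (Y : 𝒫 S) → ⟦ Y ⟧ ⊆ ⟦ X ⟧ → HasAtLeast n Y →
    Σ[ A ∈ 𝒫 S ] Σ[ B ∈ 𝒫 S ]
      ⟦ A ⟧ ∪ ⟦ B ⟧ ≐ ⟦ Y ⟧ × ⟦ A ⟧ ⊥ ⟦ B ⟧ × conv A ≬ conv B

  -- A finite ℱ ⊆ 𝒞, enumerated without repetition.
  record Family : Set (c ⊔ ℓ ⊔ k ⊔ lsuc 0ℓ) where
    field
      size     : ℕ
      set      : Fin size → 𝒫 S
      convex   : ∀ i → set i ∈ 𝒞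
      distinct : ∀ {i j} → ⟦ set i ⟧ ≐ ⟦ set j ⟧ → i ≡ j

  open Family public

  -- Subfamilies are given by their index sets.  The common point is required
  -- to lie in X, so the empty subfamily has intersection X.
  Intersects : (ℱ : Family) → Pred (Subset (size ℱ)) c
  Intersects ℱ T = ∃[ x ] x ∈ ⟦ X ⟧ × (∀ i → i ∈ˢ T → x ∈ ⟦ set ℱ i ⟧)

  NonemptyMembers : Family → Set c
  NonemptyMembers ℱ = ∀ i → Satisfiable ⟦ set ℱ i ⟧

  Pierceable : ℕ → Family → Set c
  Pierceable N ℱ =
    Σ[ s ∈ List Carrier ] length s ℕ.≤ N × All (_∈ ⟦ X ⟧) s ×
      (∀ i → Any (_∈ ⟦ set ℱ i ⟧) s)

  HellyProperty : ℕ → Set (c ⊔ ℓ ⊔ k ⊔ lsuc 0ℓ)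
  HellyProperty n =
    ∀ (ℱ : Family) → (∀ T → ∣ T ∣ ℕ.≤ n → Intersects ℱ T) → Intersects ℱ ⊤

  ColorfulHellyProperty : ℕ → Set (c ⊔ ℓ ⊔ k ⊔ lsuc 0ℓ)
  ColorfulHellyProperty n =
    ∀ (ℱ : Fin n → Family) →
    (∀ (C : ∀ i → Fin (size (ℱ i))) →
       ∃[ x ] x ∈ ⟦ X ⟧ × (∀ i → x ∈ ⟦ set (ℱ i) (C i) ⟧)) →
    ∃[ i ] Intersects (ℱ i) ⊤

  -- The bound |ℱ| ≥ m excludes the degenerate case in which the binomial
  -- coefficient vanishes: without it ℱ = {∅} would refute the property for
  -- every m ≥ 2.
  FractionalHellyProperty : ℕ → Set (c ⊔ ℓ ⊔ k ⊔ lsuc 0ℓ)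
  FractionalHellyProperty m =
    Σ[ β ∈ Func UnitInterval UnitInterval ]
    ∀ (α : Setoid.Carrier UnitInterval) (ℱ : Family) → m ℕ.≤ size ℱ →
    (Σ[ Ts ∈ List (Subset (size ℱ)) ]
       Unique Ts ×
       All (λ T → ∣ T ∣ ≡ m × Intersects ℱ T) Ts ×
       (size ℱ C m) · proj₁ α ≤ fromℕ (length Ts)) →
    Σ[ T ∈ Subset (size ℱ) ]
      Intersects ℱ T × size ℱ · proj₁ (Func.to β α) ≤ fromℕ ∣ T ∣

  -- Families containing ∅ cannot be pierced, while the hypotheses of the next
  -- two properties may hold for them (vacuously, for instance, for {∅}), hence
  -- the restriction to nonempty members.
  PQTheorem : ℕ → ℕ → Set (c ⊔ ℓ ⊔ k ⊔ lsuc 0ℓ)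
  PQTheorem p q =
    ∃[ N ] ∀ (ℱ : Family) → NonemptyMembers ℱ →
    (∀ T → ∣ T ∣ ≡ p → ∃[ U ] U ⊆ˢ T × ∣ U ∣ ≡ q × Intersects ℱ U) →
    Pierceable N ℱ

  ColorfulPQTheorem₁ : ℕ → ℕ → Set (c ⊔ ℓ ⊔ k ⊔ lsuc 0ℓ)
  ColorfulPQTheorem₁ p q =
    ∃[ N ] ∀ (ℱ : Fin q → Family) → (∀ i → NonemptyMembers (ℱ i)) →
    (∀ (C : ∀ i → Fin p → Fin (size (ℱ i))) → (∀ i → Injective _≡_ _≡_ (C i)) →
       Σ[ j ∈ (Fin q → Fin p) ]
       ∃[ x ] x ∈ ⟦ X ⟧ × (∀ i → x ∈ ⟦ set (ℱ i) (C i (j i)) ⟧)) →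
    ∃[ i ] Pierceable N (ℱ i)

  ColorfulPQTheorem₂ : ℕ → ℕ → Set (c ⊔ ℓ ⊔ k ⊔ lsuc 0ℓ)
  ColorfulPQTheorem₂ p q =
    ∃[ M ] ∀ (ℱ : Fin p → Family) →
    (∀ (C : ∀ i → Fin (size (ℱ i))) →
       Σ[ T ∈ Subset p ] ∣ T ∣ ≡ q ×
       (∃[ x ] x ∈ ⟦ X ⟧ × (∀ i → i ∈ˢ T → x ∈ ⟦ set (ℱ i) (C i) ⟧))) →
    ∃[ i ] Pierceable M (ℱ i)

------------------------------------------------------------------------
-- Separated d-intervals

Convex : Pred (Pred ℝ 0ℓ) (lsuc 0ℓ)
Convex I = ∀ {x y z} → x ≤ y → y ≤ z → x ∈ I → z ∈ I → y ∈ I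

ℝ×[_] : ℕ → Setoid (lsuc 0ℓ) 0ℓ
ℝ×[ d ] = ×-setoid ℝ-setoid (setoid (Fin d))

record Interval (d : ℕ) : Set₁ where
  field
    level  : Fin d → Pred ℝ 0ℓ
    convex : ∀ i → Convex (level i)

  points : Pred (ℝ × Fin d) 0ℓ
  points (x , i) = x ∈ level i

𝒞≡ : ∀ {d} → 𝒫 ℝ×[ d ] → Pred (𝒫 ℝ×[ d ]) (lsuc 0ℓ)
𝒞≡ {d} P K = Σ[ I ∈ Interval d ] ⟦ K ⟧ ≐ Interval.points I ∩ ⟦ P ⟧

TwoPointsInEveryLevel : ∀ {d} → 𝒫 ℝ×[ d ] → Set₁
TwoPointsInEveryLevel P =
  ∀ i → ∃₂ λ x y → ¬ x ≈ y × (x , i) ∈ ⟦ P ⟧ × (y , i) ∈ ⟦ P ⟧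

{-# OPTIONS --safe #-}

-- Order the convex subsets of a linear order by where they start, and say that A
-- enters B if they meet and B starts no later than A.  The sets entered by A have
-- a common point: the least of the points in which they meet A.  With A starting
-- last, this gives the colorful Helly theorem for two colors on each level.
-- Of two d-intervals that meet, one enters the other on some level; averaging over
-- the entering set and the level yields the fractional Helly theorem.  Moreover A
-- enters at most one of several disjoint sets on each level, so by repeated
-- halving, large families of pairwise disjoint d-intervals contain large
-- subfamilies that are disjoint from one another.
--
-- For the (p,q) theorem, induct on the levels.  Sweeping the first level from
-- right to left, cut as soon as the sets starting beyond the cut contain many
-- that are pairwise disjoint on the remaining levels.  Up to one point per cut,
-- the sets in different pieces are disjoint on the first level, so p cuts give p
-- pairwise disjoint sets by halving, while fewer cuts give a bounded piercing set.
-- The colorful (p,q) theorems follow by halving again.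
module Submission where

open import Axiom.ExcludedMiddle using (ExcludedMiddle)
open import Data.Empty using (⊥-elim)
open import Data.Fin.Base using (Fin; zero; suc; combine; remQuot; inject≤)
open import Data.Fin.Properties using (remQuot-combine; combine-remQuot; combine-injective; inject≤-injective) renaming (suc-injective to Fin-suc-injective)
open import Data.Fin.Subset as Subset using (Subset; inside; outside; ∣_∣; ⁅_⁆; _∪_)
import Data.Fin.Subset.Properties as Subset
open import Data.Integer.Base as ℤ using (+_)
import Data.Integer.Properties as ℤ
open import Data.List.Base as List using (List; []; _∷_; _++_; [_]; length; filter; map; take; drop; tabulate; allFin)
open import Data.List.Membership.Propositional using (_∈_)
open import Data.List.Membership.Propositional.Properties using (∈-filter⁺; ∈-filter⁻; ∈-tabulate⁺; ∈-tabulate⁻; ∈-lookup; ∈-allFin; ∈-map⁺; ∈-map⁻)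
open import Data.List.Properties using (length-take; length-drop; take++drop≡id; length-tabulate; length-++; length-map)
open import Data.List.Relation.Binary.Sublist.Propositional using (_⊆_; []; _∷_; _∷ʳ_; ⊆-refl; ⊆-trans; lookup)
open import Data.List.Relation.Binary.Sublist.Propositional.Properties using (All-resp-⊆; take-⊆; drop-⊆; filter-⊆; length-mono-≤) renaming (filter⁺ to filter-mono-⊆)
open import Data.List.Relation.Unary.All as All using (All; []; _∷_)
import Data.List.Relation.Unary.All.Properties as All
open import Data.List.Relation.Unary.AllPairs as AllPairs using (AllPairs; []; _∷_)
import Data.List.Relation.Unary.AllPairs.Properties as AllPairs
open import Data.List.Relation.Unary.Any as Any using (Any; here; there)
import Data.List.Relation.Unary.Any.Properties as Any
open import Data.List.Relation.Unary.Unique.Propositional using (Unique)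
import Data.List.Relation.Unary.Unique.Propositional.Properties as Unique
open import Data.Nat.Base as ℕ using (ℕ; zero; suc; _≤_; _+_; _*_; _⊔_; z≤n; s≤s)
open import Data.Nat.Combinatorics using (_C_; nC1≡n; nCk+nC[k+1]≡[n+1]C[k+1])
import Data.Nat.Coprimality as Coprime
open import Data.Nat.Properties as ℕ using (≤-trans; ≤-refl; ≤-reflexive; m≤m⊔n; m≤n⊔m; module ≤-Reasoning)
open import Data.Nat.Tactic.RingSolver using (solve-∀)
open import Data.Product.Base using (Σ; Σ-syntax; ∃; ∃₂; _×_; _,_; proj₁; proj₂; uncurry; swap)
open import Data.Rational.Base as ℚ using (ℚ; 0ℚ; 1ℚ; ½; mkℚ; 1/_; *≤*; *<*)
import Data.Rational.Properties as ℚ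
import Data.Rational.Unnormalised.Base as ℚᵘ
import Data.Rational.Unnormalised.Properties as ℚᵘ
open import Data.Sum.Base as Sum using (_⊎_; inj₁; inj₂; [_,_]′)
open import Data.Vec.Base using ([]; _∷_; here; there)
open import Defs using (ℝ; fromℚ; fromℕ; _·_; UnitInterval; 𝒫; ⟦_⟧; ℝ×[_]; ℝ-setoid; 𝒞≡; Interval; TwoPointsInEveryLevel; IsLeast; LeastAtMost; module Convexity)
open import Function.Base using (_∘_; id; flip)
open import Function.Bundles using (Func)
open import Function.Definitions using (Injective)
open import Level using (Level; 0ℓ) renaming (_⊔_ to _⊔ˡ_)
open import Relation.Binary.Bundles using (Setoid; TotalPreorder)
open import Relation.Binary.Core using (Rel)
open import Relation.Binary.Definitions using (Total; Transitive; Symmetric; tri<; tri≈; tri>)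
open import Relation.Binary.PropositionalEquality using (_≡_; _≢_; refl; sym; trans; cong; cong₂; subst; subst₂; module ≡-Reasoning)
open import Relation.Nullary.Decidable.Core using (Dec; yes; no; ¬?; decidable-stable; from-yes)
open import Relation.Nullary.Negation using (¬_; contradiction)
open import Relation.Unary as Unary using (Pred; Decidable; Satisfiable; _≬_; _≐_)

open ℝ

private
  variable
    a b c ℓ ℓ₁ ℓ₂ : Level

-- Lists and subsets of finite sets.

length-filter-split : {X : Set a} {Q : Pred X ℓ} (Q? : Decidable Q) (xs : List X) →
  length (filter Q? xs) + length (filter (¬? ∘ Q?) xs) ≡ length xs
length-filter-split Q? [] = refl
length-filter-split Q? (x ∷ xs) with Q? x
... | yes _ = cong suc (length-filter-split Q? xs)
... | no  _ = trans (ℕ.+-suc _ _) (cong suc (length-filter-split Q? xs))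

AllPairs-resp-⊆ : {X : Set a} {R : Rel X ℓ} {xs ys : List X} → xs ⊆ ys → AllPairs R ys → AllPairs R xs
AllPairs-resp-⊆ []          []       = []
AllPairs-resp-⊆ (_ ∷ʳ τ)    (_ ∷ rs) = AllPairs-resp-⊆ τ rs
AllPairs-resp-⊆ (refl ∷ τ)  (r ∷ rs) = All-resp-⊆ τ r ∷ AllPairs-resp-⊆ τ rs

AllPairs-++⁻ : {X : Set a} {R : Rel X ℓ} (xs : List X) {ys : List X} → AllPairs R (xs ++ ys) →
  ∀ {x y} → x ∈ xs → y ∈ ys → R x y
AllPairs-++⁻ (x ∷ xs) (r ∷ rs) (here refl) y∈ = All.lookup (All.++⁻ʳ xs r) y∈
AllPairs-++⁻ (x ∷ xs) (r ∷ rs) (there x∈)  y∈ = AllPairs-++⁻ xs rs x∈ y∈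

greatest : {X : Set a} {_R_ : Rel X ℓ} → Total _R_ → Transitive _R_ →
  ∀ x xs → ∃ λ m → m ∈ x ∷ xs × All (_R m) (x ∷ xs)
greatest total trans x [] = x , here refl , [ id , id ]′ (total x x) ∷ []
greatest total trans x (y ∷ ys) with greatest total trans y ys
... | m , m∈ , ms with total x m
...   | inj₁ xRm = m , there m∈ , xRm ∷ ms
...   | inj₂ mRx = x , here refl , [ id , id ]′ (total x x) ∷ All.map (λ r → trans r mRx) ms

m+m≤n⇒m≤n : ∀ {m n} → m + m ≤ n → m ≤ n
m+m≤n⇒m≤n = ≤-trans (ℕ.m≤m+n _ _)


AllPairs-lookup : {X : Set a} {R : Rel X ℓ} → Symmetric R → ∀ {xs} → AllPairs R xs →
  ∀ {i j} → i ≢ j → R (List.lookup xs i) (List.lookup xs j)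
AllPairs-lookup R-sym (r ∷ rs) {zero}  {zero}  i≢j = contradiction refl i≢j
AllPairs-lookup R-sym (r ∷ rs) {zero}  {suc j} i≢j = All.lookup r (∈-lookup j)
AllPairs-lookup R-sym (r ∷ rs) {suc i} {zero}  i≢j = R-sym (All.lookup r (∈-lookup i))
AllPairs-lookup R-sym (r ∷ rs) {suc i} {suc j} i≢j = AllPairs-lookup R-sym rs (i≢j ∘ cong suc)

remQuot-injective : ∀ {n} k {i j : Fin (n * k)} → remQuot {n} k i ≡ remQuot {n} k j → i ≡ j
remQuot-injective {n} k {i} {j} eq =
  trans (sym (combine-remQuot {n} k i)) (trans (cong (uncurry combine) eq) (combine-remQuot {n} k j))

∣p∪q∣≤∣p∣+∣q∣ : ∀ {n} (p q : Subset n) → ∣ p ∪ q ∣ ℕ.≤ ∣ p ∣ ℕ.+ ∣ q ∣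
∣p∪q∣≤∣p∣+∣q∣ []            []            = z≤n
∣p∪q∣≤∣p∣+∣q∣ (outside ∷ p) (outside ∷ q) = ∣p∪q∣≤∣p∣+∣q∣ p q
∣p∪q∣≤∣p∣+∣q∣ (outside ∷ p) (inside  ∷ q) =
  ℕ.≤-trans (s≤s (∣p∪q∣≤∣p∣+∣q∣ p q)) (ℕ.≤-reflexive (sym (ℕ.+-suc ∣ p ∣ ∣ q ∣)))
∣p∪q∣≤∣p∣+∣q∣ (inside  ∷ p) (outside ∷ q) = s≤s (∣p∪q∣≤∣p∣+∣q∣ p q)
∣p∪q∣≤∣p∣+∣q∣ (inside  ∷ p) (inside  ∷ q) =
  s≤s (ℕ.≤-trans (∣p∪q∣≤∣p∣+∣q∣ p q) (ℕ.+-monoʳ-≤ ∣ p ∣ (ℕ.n≤1+n ∣ q ∣)))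

fromList : ∀ {n} → List (Fin n) → Subset n
fromList []       = Subset.⊥
fromList (x ∷ xs) = ⁅ x ⁆ ∪ fromList xs

∣fromList∣≤length : ∀ {n} (xs : List (Fin n)) → ∣ fromList xs ∣ ℕ.≤ length xs
∣fromList∣≤length {n} [] = ℕ.≤-reflexive (Subset.∣⊥∣≡0 n)
∣fromList∣≤length (x ∷ xs) = ℕ.≤-trans (∣p∪q∣≤∣p∣+∣q∣ ⁅ x ⁆ (fromList xs))
  (ℕ.+-mono-≤ (ℕ.≤-reflexive (Subset.∣⁅x⁆∣≡1 x)) (∣fromList∣≤length xs))

∈-fromList⁺ : ∀ {n} {x : Fin n} {xs} → x ∈ xs → x Subset.∈ fromList xs
∈-fromList⁺ {xs = y ∷ xs} (here refl) = Subset.x∈p∪q⁺ (inj₁ (Subset.x∈⁅x⁆ y))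
∈-fromList⁺ {xs = y ∷ xs} (there x∈)  = Subset.x∈p∪q⁺ {p = ⁅ y ⁆} (inj₂ (∈-fromList⁺ x∈))

∈-fromList⁻ : ∀ {n} {x : Fin n} xs → x Subset.∈ fromList xs → x ∈ xs
∈-fromList⁻ []       x∈ = contradiction x∈ Subset.∉⊥
∈-fromList⁻ (y ∷ xs) x∈ =
  [ here ∘ Subset.x∈⁅y⁆⇒x≡y y , there ∘ ∈-fromList⁻ xs ]′ (Subset.x∈p∪q⁻ ⁅ y ⁆ (fromList xs) x∈)

unique⇒length≤∣p∣ : ∀ {n} {p : Subset n} xs → Unique xs → All (Subset._∈ p) xs → length xs ℕ.≤ ∣ p ∣
unique⇒length≤∣p∣ []       _         _          = z≤n
unique⇒length≤∣p∣ (x ∷ xs) (x∉ ∷ u) (x∈p ∷ xs⊆p) = ℕ.≤-<-trans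
  (unique⇒length≤∣p∣ xs u (All.zipWith (λ (y∈p , x≢y) → Subset.x∈p∧x≢y⇒x∈p-y y∈p (x≢y ∘ sym)) (xs⊆p , x∉)))
  (Subset.x∈p⇒∣p-x∣<∣p∣ x∈p)

∣p∣≡1⇒singleton : ∀ {n} (p : Subset n) → ∣ p ∣ ≡ 1 → ∃ λ i → p ≡ ⁅ i ⁆
∣p∣≡1⇒singleton (outside ∷ p) eq = let i , p≡ = ∣p∣≡1⇒singleton p eq in suc i , cong (outside ∷_) p≡
∣p∣≡1⇒singleton (inside  ∷ p) eq = zero , cong (inside ∷_) (∣p∣≡0⇒⊥ p (ℕ.suc-injective eq))
  where
  ∣p∣≡0⇒⊥ : ∀ {n} (p : Subset n) → ∣ p ∣ ≡ 0 → p ≡ Subset.⊥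
  ∣p∣≡0⇒⊥ []            _  = refl
  ∣p∣≡0⇒⊥ (outside ∷ p) eq = cong (outside ∷_) (∣p∣≡0⇒⊥ p eq)

∣p∣≡2⇒pair : ∀ {n} (p : Subset n) → ∣ p ∣ ≡ 2 → ∃₂ λ i j → i ≢ j × p ≡ ⁅ i ⁆ ∪ ⁅ j ⁆
∣p∣≡2⇒pair (outside ∷ p) eq = let i , j , i≢j , p≡ = ∣p∣≡2⇒pair p eq in
  suc i , suc j , i≢j ∘ Fin-suc-injective , cong (outside ∷_) p≡
∣p∣≡2⇒pair (inside ∷ p) eq = let j , p≡ = ∣p∣≡1⇒singleton p (ℕ.suc-injective eq) in
  zero , suc j , (λ ()) , cong (inside ∷_) (trans p≡ (sym (Subset.∪-identityˡ ⁅ j ⁆)))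

0<∣p∣⇒nonempty : ∀ {n} (p : Subset n) → 0 ℕ.< ∣ p ∣ → ∃ (Subset._∈ p)
0<∣p∣⇒nonempty (outside ∷ p) 0< = let i , i∈ = 0<∣p∣⇒nonempty p 0< in suc i , there i∈
0<∣p∣⇒nonempty (inside  ∷ p) _  = zero , here

1<∣p∣⇒distinct : ∀ {n} (p : Subset n) → 1 ℕ.< ∣ p ∣ → ∃₂ λ i j → i ≢ j × i Subset.∈ p × j Subset.∈ p
1<∣p∣⇒distinct (outside ∷ p) 1< = let i , j , i≢j , i∈ , j∈ = 1<∣p∣⇒distinct p 1< in
  suc i , suc j , i≢j ∘ Fin-suc-injective , there i∈ , there j∈
1<∣p∣⇒distinct (inside ∷ p) (s≤s 0<) = let j , j∈ = 0<∣p∣⇒nonempty p 0< in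
  zero , suc j , (λ ()) , here , there j∈

-- Multiples of reals

ι : ℕ → ℚ
ι n = + n ℚ./ 1

ι≡mkℚ : ∀ n → ι n ≡ mkℚ (+ n) 0 (Coprime.sym (Coprime.1-coprimeTo n))
ι≡mkℚ n = ℚ.↥p/↧p≡p (mkℚ (+ n) 0 (Coprime.sym (Coprime.1-coprimeTo n)))

ι-suc : ∀ n → ι (suc n) ≡ 1ℚ ℚ.+ ι n
ι-suc n rewrite ι≡mkℚ n | ι≡mkℚ (suc n) = ℚ.toℚᵘ-injective (ℚᵘ.≃-trans (ℚᵘ.*≡* eq)
  (ℚᵘ.≃-sym (ℚ.toℚᵘ-homo-+ 1ℚ (mkℚ (+ n) 0 (Coprime.sym (Coprime.1-coprimeTo n))))))
  where
  eq : + suc n ℤ.* + 1 ≡ (+ 1 ℤ.* + 1 ℤ.+ + n ℤ.* + 1) ℤ.* + 1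
  eq = cong (ℤ._* + 1) (cong (ℤ._+_ (+ 1)) (sym (ℤ.*-identityʳ (+ n))))

ι-* : ∀ m n → ι (m ℕ.* n) ≡ ι m ℚ.* ι n
ι-* zero    n = sym (ℚ.*-zeroˡ (ι n))
ι-* (suc m) n = begin
  ι (n ℕ.+ m ℕ.* n)           ≡⟨ ι-+ n (m ℕ.* n) ⟩
  ι n ℚ.+ ι (m ℕ.* n)         ≡⟨ cong₂ ℚ._+_ (sym (ℚ.*-identityˡ (ι n))) (ι-* m n) ⟩
  1ℚ ℚ.* ι n ℚ.+ ι m ℚ.* ι n  ≡⟨ ℚ.*-distribʳ-+ (ι n) 1ℚ (ι m) ⟨
  (1ℚ ℚ.+ ι m) ℚ.* ι n        ≡⟨ cong (ℚ._* ι n) (ι-suc m) ⟨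
  ι (suc m) ℚ.* ι n           ∎
  where
  open ≡-Reasoning
  ι-+ : ∀ m n → ι (m ℕ.+ n) ≡ ι m ℚ.+ ι n
  ι-+ zero    n = sym (ℚ.+-identityˡ (ι n))
  ι-+ (suc m) n rewrite ι-suc (m ℕ.+ n) | ι-suc m | ι-+ m n = sym (ℚ.+-assoc 1ℚ (ι m) (ι n))

ι-mono-≤ : ∀ {m n} → m ℕ.≤ n → ι m ℚ.≤ ι n
ι-mono-≤ {m} {n} m≤n rewrite ι≡mkℚ m | ι≡mkℚ n = *≤* (ℤ.*-monoʳ-≤-nonNeg (+ 1) (ℤ.+≤+ m≤n))

0≤ι : ∀ n → 0ℚ ℚ.≤ ι n
0≤ι n = ι-mono-≤ (z≤n {n})

archimedean : ∀ q → ∃ λ n → q ℚ.< ι (suc n)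
archimedean q@(mkℚ (+ m) d-1 _) = m , subst (q ℚ.<_) (sym (ι≡mkℚ (suc m)))
  (*<* (subst₂ ℤ._<_ (sym (ℤ.*-identityʳ (+ m))) (ℤ.pos-* (suc m) (suc d-1))
    (ℤ.+<+ (ℕ.<-≤-trans (ℕ.n<1+n m) (ℕ.m≤m*n (suc m) (suc d-1))))))
archimedean q@(mkℚ ℤ.-[1+ m ] _ _) = 0 , ℚ.<-trans (ℚ.negative⁻¹ q) (ℚ.positive⁻¹ 1ℚ)

module _ (x : ℝ) where

  -- A rational below the sum is `s + t` with `s` below `x` and, inductively, `t` below `n` times
  -- some `r`; the larger of `s` and `r` serves all summands at once. For `n = 0` any rational below
  -- `x` will do.
  ·-lower⁻ : ∀ n {q} → lower (n · x) q → ∃ λ r → lower x r × q ℚ.< ι n ℚ.* r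
  ·-lower⁻ zero q<0 = let r , r∈ = inhabited x in r , r∈ , subst (_ ℚ.<_) (sym (ℚ.*-zeroˡ r)) q<0
  ·-lower⁻ (suc n) {q} (s , t , s∈ , t∈ , refl) with ·-lower⁻ n t∈
  ... | r , r∈ , t<nr = pick (ℚ.≤-total s r)
    where
    bound : ∀ {u} → s ℚ.≤ u → r ℚ.≤ u → s ℚ.+ t ℚ.< ι (suc n) ℚ.* u
    bound {u} s≤u r≤u = begin-strict
      s ℚ.+ t                   <⟨ ℚ.+-mono-≤-< s≤u t<nr ⟩
      u ℚ.+ ι n ℚ.* r           ≤⟨ ℚ.+-monoʳ-≤ u (ℚ.*-monoˡ-≤-nonNeg (ι n) {{ℚ.nonNegative (0≤ι n)}} r≤u) ⟩
      u ℚ.+ ι n ℚ.* u           ≡⟨ cong (ℚ._+ ι n ℚ.* u) (ℚ.*-identityˡ u) ⟨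
      1ℚ ℚ.* u ℚ.+ ι n ℚ.* u    ≡⟨ ℚ.*-distribʳ-+ u 1ℚ (ι n) ⟨
      (1ℚ ℚ.+ ι n) ℚ.* u        ≡⟨ cong (ℚ._* u) (ι-suc n) ⟨
      ι (suc n) ℚ.* u           ∎
      where open ℚ.≤-Reasoning
    pick : s ℚ.≤ r ⊎ r ℚ.≤ s → ∃ λ u → lower x u × s ℚ.+ t ℚ.< ι (suc n) ℚ.* u
    pick (inj₁ s≤r) = r , r∈ , bound s≤r ℚ.≤-refl
    pick (inj₂ r≤s) = s , s∈ , bound ℚ.≤-refl r≤s

  -- Splitting `q` as `r + (q - r)` leaves a remainder below `n` copies of `r`, so induction
  -- applies. Together with `·-lower⁻` this turns inequalities about multiples of reals into
  -- inequalities between rationals.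
  ·-lower⁺ : ∀ n {q r} → lower x r → q ℚ.< ι n ℚ.* r → lower (n · x) q
  ·-lower⁺ zero    {q} {r} _ q<0r = subst (q ℚ.<_) (ℚ.*-zeroˡ r) q<0r
  ·-lower⁺ (suc n) {q} {r} r∈ q< = r , q ℚ.- r , r∈ , ·-lower⁺ n r∈ q-r< , sym r+[q-r]≡q
    where
    r+[q-r]≡q : r ℚ.+ (q ℚ.- r) ≡ q
    r+[q-r]≡q = trans (ℚ.+-comm r (q ℚ.- r)) (trans (ℚ.+-assoc q (ℚ.- r) r)
      (trans (cong (q ℚ.+_) (ℚ.+-inverseˡ r)) (ℚ.+-identityʳ q)))
    q-r< : q ℚ.- r ℚ.< ι n ℚ.* r
    q-r< = ℚ.≰⇒> λ nr≤ → ℚ.<-irrefl refl (begin-strict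
      q                        <⟨ q< ⟩
      ι (suc n) ℚ.* r          ≡⟨ cong (ℚ._* r) (ι-suc n) ⟩
      (1ℚ ℚ.+ ι n) ℚ.* r       ≡⟨ ℚ.*-distribʳ-+ r 1ℚ (ι n) ⟩
      1ℚ ℚ.* r ℚ.+ ι n ℚ.* r   ≡⟨ cong (ℚ._+ ι n ℚ.* r) (ℚ.*-identityˡ r) ⟩
      r ℚ.+ ι n ℚ.* r          ≤⟨ ℚ.+-monoʳ-≤ r nr≤ ⟩
      r ℚ.+ (q ℚ.- r)          ≡⟨ r+[q-r]≡q ⟩
      q                        ∎)
      where open ℚ.≤-Reasoning

lower<upper : ∀ x {q r} → lower x q → ¬ lower x r → q ℚ.< r
lower<upper x {q} {r} q∈ r∉ with ℚ.<-cmp q r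
... | tri< q<r _ _  = q<r
... | tri≈ _ refl _ = contradiction q∈ r∉
... | tri> _ _ r<q  = contradiction (closed x r<q q∈) r∉

n·x≤n : ∀ {x} → x Defs.< fromℕ 1 → ∀ n → n · x Defs.≤ fromℕ n
n·x≤n {x} (q , q<1 , q∉x) n p∈ = let r , r∈ , p<nr = ·-lower⁻ x n p∈ in
  ℚ.<-≤-trans p<nr (subst (ι n ℚ.* r ℚ.≤_) (ℚ.*-identityʳ (ι n))
    (ℚ.*-monoˡ-≤-nonNeg (ι n) {{ℚ.nonNegative (0≤ι n)}} (ℚ.<⇒≤ (ℚ.<-trans (lower<upper x r∈ q∉x) q<1))))

n·x≤m⇒n*r≤m : ∀ {x} n m → n · x Defs.≤ fromℕ m → ∀ {r} → lower x r → ι n ℚ.* r ℚ.≤ ι m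
n·x≤m⇒n*r≤m {x} n m h r∈ = ℚ.≮⇒≥ λ m<nr → ℚ.<-irrefl refl (h (·-lower⁺ x n r∈ m<nr))

-- A positive rational below `x` has a multiple exceeding `1` by the Archimedean property. Applied
-- to `β(½)`, this gives the size of the family that bounds the fractional Helly number from below.
positive-multiple : ∀ {x} → fromℕ 0 Defs.< x → ∃ λ n → ¬ (suc n · x Defs.≤ fromℕ 1)
positive-multiple {x} (q , q∈ , q≮0) =
  let r , q<r , r∈ = rounded x q∈
      instance r-pos = ℚ.positive (ℚ.≤-<-trans (ℚ.≮⇒≥ q≮0) q<r)
      instance r-nonZero = ℚ.pos⇒nonZero r
      n , 1/r<n = archimedean (1/ r)
  in n , λ h → ℚ.<-irrefl refl (ℚ.<-≤-trans
       (subst (ℚ._< ι (suc n) ℚ.* r) (ℚ.*-inverseˡ r) (ℚ.*-monoˡ-<-pos r 1/r<n))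
       (n·x≤m⇒n*r≤m (suc n) 1 h r∈))

-- Division of reals by a positive rational.

module _ (c : ℚ) {{c-pos : ℚ.Positive c}} where

  private instance
    c-nonZero = ℚ.pos⇒nonZero c

  [p/c]*c≡p : ∀ p → (p ℚ.* 1/ c) ℚ.* c ≡ p
  [p/c]*c≡p p = trans (ℚ.*-assoc p (1/ c) c) (trans (cong (p ℚ.*_) (ℚ.*-inverseˡ c)) (ℚ.*-identityʳ p))

  infixl 7 _÷
  -- Rescaling the cut avoids multiplying reals; with `c = 4 d` this is the quotient from which `β`
  -- is formed.
  _÷ : ℝ → ℝ
  x ÷ = record
    { lower     = λ q → lower x (q ℚ.* c)
    ; inhabited = let p , p∈ = inhabited x in p ℚ.* 1/ c , subst (lower x) (sym ([p/c]*c≡p p)) p∈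
    ; bounded   = let p , p∉ = bounded x in p ℚ.* 1/ c , λ p∈ → p∉ (subst (lower x) ([p/c]*c≡p p) p∈)
    ; closed    = λ r<q → closed x (ℚ.*-monoˡ-<-pos c r<q)
    ; rounded   = λ {q} q∈ → let p , qc<p , p∈ = rounded x q∈ in
                    p ℚ.* 1/ c ,
                    ℚ.*-cancelʳ-<-nonNeg c {{ℚ.pos⇒nonNeg c}} (subst (q ℚ.* c ℚ.<_) (sym ([p/c]*c≡p p)) qc<p) ,
                    subst (lower x) (sym ([p/c]*c≡p p)) p∈
    }

  0<x÷ : ∀ {x} → fromℕ 0 Defs.< x → fromℕ 0 Defs.< x ÷
  0<x÷ {x} (q , q∈ , q≮0) = q ℚ.* 1/ c , subst (lower x) (sym ([p/c]*c≡p q)) q∈ , λ q/c<0 →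
    q≮0 (subst₂ ℚ._<_ ([p/c]*c≡p q) (ℚ.*-zeroˡ c) (ℚ.*-monoˡ-<-pos c q/c<0))

  x÷<1 : 1ℚ ℚ.≤ c → ∀ {x} → fromℕ 0 Defs.< x → x Defs.< fromℕ 1 → x ÷ Defs.< fromℕ 1
  x÷<1 1≤c {x} (p , p∈ , p≮0) (q , q<1 , q∉) = q , q<1 , λ qc∈ →
    ℚ.<-irrefl refl (ℚ.<-≤-trans (lower<upper x qc∈ q∉)
      (subst (ℚ._≤ q ℚ.* c) (ℚ.*-identityʳ q)
        (ℚ.*-monoˡ-≤-nonNeg q {{ℚ.nonNegative (ℚ.≤-trans (ℚ.≮⇒≥ p≮0) (ℚ.<⇒≤ (lower<upper x p∈ q∉)))}} 1≤c)))

-- Arithmetic of the fractional Helly bound.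

n²≤4nC2 : ∀ n → 2 ℕ.≤ n → n ℕ.* n ℕ.≤ 4 ℕ.* (n C 2)
n²≤4nC2 (suc zero) (s≤s ())
n²≤4nC2 (suc (suc zero)) _ = ℕ.≤-refl
-- From `n` to `n + 1` the left side grows by `2n + 1` and the right side by `4n`, starting from
-- equality at `2`.
n²≤4nC2 (suc n@(suc (suc k))) _ = begin
  suc n ℕ.* suc n                   ≡⟨ expand n ⟩
  n ℕ.* n ℕ.+ (2 ℕ.* n ℕ.+ 1)       ≤⟨ ℕ.+-mono-≤ (n²≤4nC2 n (s≤s (s≤s z≤n))) 2n+1≤4n ⟩
  4 ℕ.* (n C 2) ℕ.+ 4 ℕ.* n         ≡⟨ ℕ.+-comm (4 ℕ.* (n C 2)) (4 ℕ.* n) ⟩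
  4 ℕ.* n ℕ.+ 4 ℕ.* (n C 2)         ≡⟨ ℕ.*-distribˡ-+ 4 n (n C 2) ⟨
  4 ℕ.* (n ℕ.+ n C 2)               ≡⟨ cong (λ m → 4 ℕ.* (m ℕ.+ n C 2)) (nC1≡n n) ⟨
  4 ℕ.* (n C 1 ℕ.+ n C 2)           ≡⟨ cong (4 ℕ.*_) (nCk+nC[k+1]≡[n+1]C[k+1] n 1) ⟩
  4 ℕ.* (suc n C 2)                 ∎
  where
  open ℕ.≤-Reasoning
  expand : ∀ n → suc n ℕ.* suc n ≡ n ℕ.* n ℕ.+ (2 ℕ.* n ℕ.+ 1)
  expand = solve-∀
  split : ∀ n → 4 ℕ.* n ≡ 2 ℕ.* n ℕ.+ 2 ℕ.* n
  split = solve-∀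
  2n+1≤4n : 2 ℕ.* n ℕ.+ 1 ℕ.≤ 4 ℕ.* n
  2n+1≤4n = subst (2 ℕ.* n ℕ.+ 1 ℕ.≤_) (sym (split n)) (ℕ.+-monoʳ-≤ (2 ℕ.* n) (s≤s z≤n))

[1+n]·x≰0 : ∀ {x} → fromℕ 0 Defs.< x → ∀ n → ¬ (suc n · x Defs.≤ fromℕ 0)
[1+n]·x≰0 {x} (q , q∈ , q≮0) n h =
  let r , q<r , r∈ = rounded x q∈
      0<r = ℚ.≤-<-trans (ℚ.≮⇒≥ q≮0) q<r
      1≤ι = ι-mono-≤ (s≤s (z≤n {n}))
  in ℚ.<-irrefl refl (h (·-lower⁺ x (suc n) r∈ (ℚ.<-≤-trans 0<r
       (subst (ℚ._≤ ι (suc n) ℚ.* r) (ℚ.*-identityˡ r)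
         (ℚ.*-monoʳ-≤-nonNeg r {{ℚ.nonNegative (ℚ.<⇒≤ 0<r)}} 1≤ι)))))

-- Combining `n² ≤ 4 C(n,2)` with the two bounds on `m` gives `n d · n r ≤ n d · t`, and `n d`
-- cancels. The case `r ≤ 0` is treated apart, since multiplying by `r` preserves inequalities only
-- for `r ≥ 0`.
fractional-bound : ∀ {n d t m r} → 2 ℕ.≤ n → 1 ℕ.≤ d → m ℕ.≤ n ℕ.* d ℕ.* t →
  ι (n C 2) ℚ.* (r ℚ.* ι (4 ℕ.* d)) ℚ.≤ ι m → ι n ℚ.* r ℚ.≤ ι t
fractional-bound {n@(suc _)} {d@(suc _)} {t} {m} {r} 2≤n 1≤d m≤ndt h with ℚ.≤-total r 0ℚ
... | inj₁ r≤0 = begin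
  ι n ℚ.* r   ≤⟨ ℚ.*-monoˡ-≤-nonNeg (ι n) {{ℚ.nonNegative (0≤ι n)}} r≤0 ⟩
  ι n ℚ.* 0ℚ  ≡⟨ ℚ.*-zeroʳ (ι n) ⟩
  0ℚ          ≤⟨ 0≤ι t ⟩
  ι t         ∎
  where open ℚ.≤-Reasoning
... | inj₂ 0≤r = ℚ.*-cancelˡ-≤-pos (ι (n ℕ.* d)) {{ℚ.positive 0<nd}} (begin
  ι (n ℕ.* d) ℚ.* (ι n ℚ.* r)          ≡⟨ ℚ.*-assoc (ι (n ℕ.* d)) (ι n) r ⟨
  ι (n ℕ.* d) ℚ.* ι n ℚ.* r            ≡⟨ cong (ℚ._* r) (ι-* (n ℕ.* d) n) ⟨
  ι (n ℕ.* d ℕ.* n) ℚ.* r              ≤⟨ ℚ.*-monoʳ-≤-nonNeg r {{ℚ.nonNegative 0≤r}} (ι-mono-≤ n²d≤) ⟩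
  ι ((n C 2) ℕ.* (4 ℕ.* d)) ℚ.* r      ≡⟨ cong (ℚ._* r) (ι-* (n C 2) (4 ℕ.* d)) ⟩
  ι (n C 2) ℚ.* ι (4 ℕ.* d) ℚ.* r      ≡⟨ ℚ.*-assoc (ι (n C 2)) (ι (4 ℕ.* d)) r ⟩
  ι (n C 2) ℚ.* (ι (4 ℕ.* d) ℚ.* r)    ≡⟨ cong (ι (n C 2) ℚ.*_) (ℚ.*-comm (ι (4 ℕ.* d)) r) ⟩
  ι (n C 2) ℚ.* (r ℚ.* ι (4 ℕ.* d))    ≤⟨ h ⟩
  ι m                                  ≤⟨ ι-mono-≤ m≤ndt ⟩
  ι (n ℕ.* d ℕ.* t)                    ≡⟨ ι-* (n ℕ.* d) t ⟩
  ι (n ℕ.* d) ℚ.* ι t                  ∎)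
  where
  open ℚ.≤-Reasoning
  0<nd : 0ℚ ℚ.< ι (n ℕ.* d)
  0<nd = ℚ.<-≤-trans (ℚ.positive⁻¹ 1ℚ) (ι-mono-≤ {1} {n ℕ.* d} (s≤s z≤n))
  rearrange₁ : ∀ n d → n ℕ.* d ℕ.* n ≡ n ℕ.* n ℕ.* d
  rearrange₁ = solve-∀
  rearrange₂ : ∀ c d → 4 ℕ.* c ℕ.* d ≡ c ℕ.* (4 ℕ.* d)
  rearrange₂ = solve-∀
  n²d≤ : n ℕ.* d ℕ.* n ℕ.≤ (n C 2) ℕ.* (4 ℕ.* d)
  n²d≤ = subst₂ ℕ._≤_ (sym (rearrange₁ n d)) (rearrange₂ (n C 2) d) (ℕ.*-monoˡ-≤ d (n²≤4nC2 n 2≤n))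

half : Setoid.Carrier UnitInterval
half = fromℚ ½ , (0ℚ , ℚ.positive⁻¹ ½ , ℚ.<-irrefl refl) , (½ , from-yes (½ ℚ.<? 1ℚ) , ℚ.<-irrefl refl)

module Classical (em : ∀ {ℓ} → ExcludedMiddle ℓ) where

  dec : (Q : Set ℓ) → Dec Q
  dec Q = em

  stable : {Q : Set ℓ} → ¬ ¬ Q → Q
  stable = decidable-stable em

  all? : {X : Set a} (Q : Pred X ℓ) → Decidable Q
  all? Q x = em

  ¬∀⇒∃¬ : {X : Set a} {Q : Pred X ℓ} → ¬ (∀ x → Q x) → ∃ λ x → ¬ Q x
  ¬∀⇒∃¬ ¬∀ = stable λ ¬∃ → ¬∀ λ x → stable λ ¬q → ¬∃ (x , ¬q)

  -- Convex subsets of a linear order.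

  module Line (O : TotalPreorder a ℓ₁ ℓ₂) {I : Set c}
    (A : I → Pred (TotalPreorder.Carrier O) ℓ)
    (convex : ∀ i {x y z} → TotalPreorder._≲_ O x y → TotalPreorder._≲_ O y z → A i x → A i z → A i y)
    where

    open TotalPreorder O using (Carrier; _≲_; total) renaming (refl to ≲-refl; trans to ≲-trans)

    infix 4 _⊴_

    -- A b starts no later than A a.
    _⊴_ : Rel I (a ⊔ˡ ℓ ⊔ˡ ℓ₂)
    b ⊴ a = ∀ {x} → A a x → ∃ λ y → A b y × y ≲ x

    ⊴-trans : Transitive _⊴_
    ⊴-trans c⊴b b⊴a x∈a =
      let y , y∈b , y≲x = b⊴a x∈a ; z , z∈c , z≲y = c⊴b y∈b in z , z∈c , ≲-trans z≲y y≲x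

    -- If `b ⊴ a` fails at a point `x` of `a`, no point of `b` is at or before `x`; by totality `x`
    -- then precedes all of `b`, which shows that `a` starts no later.
    ⊴-total : Total _⊴_
    ⊴-total b a with dec (b ⊴ a)
    ... | yes b⊴a = inj₁ b⊴a
    ... | no ¬b⊴a = inj₂ λ {y} y∈b →
      let x , ¬imp = ¬∀⇒∃¬ {Q = λ x → A a x → ∃ λ y → A b y × y ≲ x} λ f → ¬b⊴a (f _)
          x∈a = stable λ x∉a → ¬imp λ x∈a → contradiction x∈a x∉a
      in x , x∈a , [ id , (λ y≲x → ⊥-elim (¬imp λ _ → y , y∈b , y≲x)) ]′ (total x y)

    -- The least of the points x, x_b ∈ A a ∩ A b lies in every A b.
    common-point : ∀ a bs {x} → A a x → (∀ {b} → b ∈ bs → b ⊴ a × A a ≬ A b) →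
      ∃ λ y → A a y × (∀ {b} → b ∈ bs → A b y)
    common-point a [] x∈a _ = _ , x∈a , λ ()
    common-point a (b ∷ bs) x∈a h with common-point a bs x∈a (h ∘ there)
    ... | x , x∈a , x∈bs with h (here refl)
    ...   | b⊴a , y , y∈a , y∈b with total x y
    ...     | inj₁ x≲y = x , x∈a , λ where
              (here refl) → let _ , z∈b , z≲x = b⊴a x∈a in convex b z≲x x≲y z∈b y∈b
              (there c∈)  → x∈bs c∈
    ...     | inj₂ y≲x = y , y∈a , λ where
              (here refl) → y∈b
              {c} (there c∈) → let _ , z∈c , z≲y = proj₁ (h (there c∈)) y∈a in
                               convex c z≲y y≲x z∈c (x∈bs c∈)

    -- Take the last-starting set of each color. The later of the two meets every set of the other
    -- color, and these start no later than it, so `common-point` applies to that other color.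
    colorful-Helly : ∀ a as b bs →
      (∀ {a′ b′} → a′ ∈ a ∷ as → b′ ∈ b ∷ bs → A a′ ≬ A b′) →
      (∃ λ x → ∀ {a′} → a′ ∈ a ∷ as → A a′ x) ⊎ (∃ λ x → ∀ {b′} → b′ ∈ b ∷ bs → A b′ x)
    colorful-Helly a as b bs meet
      with greatest ⊴-total ⊴-trans a as | greatest ⊴-total ⊴-trans b bs
    ... | m , m∈ , ms | n , n∈ , ns with ⊴-total m n
    ...   | inj₁ m⊴n = inj₁ (
            let _ , _ , x∈n = meet m∈ n∈
                x , _ , x∈ = common-point n (a ∷ as) x∈n λ c∈ →
                               ⊴-trans (All.lookup ms c∈) m⊴n ,
                               (let y , p , q = meet c∈ n∈ in y , q , p)
            in x , x∈)
    ...   | inj₂ n⊴m = inj₂ (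
            let _ , x∈m , _ = meet m∈ n∈
                x , _ , x∈ = common-point m (b ∷ bs) x∈m λ c∈ →
                               ⊴-trans (All.lookup ns c∈) n⊴m , meet m∈ c∈
            in x , x∈)

    Enters : Rel I (a ⊔ˡ ℓ ⊔ˡ ℓ₂)
    Enters a b = b ⊴ a × A a ≬ A b

    meet⇒enters : ∀ {a b} → A a ≬ A b → Enters a b ⊎ Enters b a
    meet⇒enters {a} {b} (x , x∈a , x∈b) with ⊴-total a b
    ... | inj₁ a⊴b = inj₂ (a⊴b , x , x∈b , x∈a)
    ... | inj₂ b⊴a = inj₁ (b⊴a , x , x∈a , x∈b)

    enters-disjoint : ∀ {a b c} → ¬ A b ≬ A c → Enters a b → ¬ Enters a c
    enters-disjoint {a} {b} {c} ¬bc ab@(_ , _ , x∈a , _) ac =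
      let y , _ , y∈ = common-point a (b ∷ c ∷ []) x∈a λ where
                         (here refl)         → ab
                         (there (here refl)) → ac
      in ¬bc (y , y∈ (here refl) , y∈ (there (here refl)))

    Separated : Rel I (a ⊔ˡ ℓ)
    Separated a b = ¬ A a ≬ A b

    -- Each member of xs enters a member of at most one of the two halves of ys.
    halve : ∀ m xs ys → AllPairs Separated ys → m + m ≤ length xs → m + m ≤ length ys →
      ∃₂ λ xs′ ys′ → xs′ ⊆ xs × ys′ ⊆ ys × m ≤ length xs′ × m ≤ length ys′ ×
        (∀ {a b} → a ∈ xs′ → b ∈ ys′ → ¬ Enters a b)
    halve m xs ys sep 2m≤xs 2m≤ys = by-cases (ℕ.≤-total m (length (filter E? xs)))
      where
      ys₁ = take m ys
      ys₂ = drop m ys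
      E? = all? (λ a → ∃ λ b → b ∈ ys₁ × Enters a b)

      m≤ys₁ : m ≤ length ys₁
      m≤ys₁ = ≤-reflexive (sym (trans (length-take m ys) (ℕ.m≤n⇒m⊓n≡m (m+m≤n⇒m≤n 2m≤ys))))

      m≤ys₂ : m ≤ length ys₂
      m≤ys₂ = subst (m ≤_) (sym (length-drop m ys)) (ℕ.m+n≤o⇒m≤o∸n m 2m≤ys)

      by-cases : m ≤ length (filter E? xs) ⊎ length (filter E? xs) ≤ m → _
      -- Members that enter the first half are paired with the second half, where `enters-disjoint`
      -- forbids them to enter anything. If they are too few, the remaining members are paired with
      -- the first half.
      by-cases (inj₁ m≤E) =
        filter E? xs , ys₂ , filter-⊆ E? xs , drop-⊆ m ys , m≤E , m≤ys₂ , λ {_} {_} a∈ b∈ enters →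
          let _ , c∈ , enters′ = proj₂ (∈-filter⁻ E? {xs = xs} a∈) in
          enters-disjoint
            (AllPairs-++⁻ ys₁ (subst (AllPairs Separated) (sym (take++drop≡id m ys)) sep) c∈ b∈)
            enters′ enters
      by-cases (inj₂ E≤m) =
        filter (¬? ∘ E?) xs , ys₁ , filter-⊆ (¬? ∘ E?) xs , take-⊆ m ys ,
        ℕ.+-cancelˡ-≤ m _ _ (≤-trans 2m≤xs (≤-trans (≤-reflexive (sym (length-filter-split E? xs)))
          (ℕ.+-monoˡ-≤ _ E≤m))) ,
        m≤ys₁ , λ {_} {_} a∈ b∈ enters → proj₂ (∈-filter⁻ (¬? ∘ E?) {xs = xs} a∈) (_ , b∈ , enters)

    -- Two halvings with exchanged roles exclude entry in either direction, while of two sets that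
    -- meet one enters the other. Each halving costs a factor of two.
    separate : ∀ m xs ys → AllPairs Separated xs → AllPairs Separated ys →
      (m + m) + (m + m) ≤ length xs → (m + m) + (m + m) ≤ length ys →
      ∃₂ λ xs′ ys′ → xs′ ⊆ xs × ys′ ⊆ ys × m ≤ length xs′ × m ≤ length ys′ ×
        (∀ {a b} → a ∈ xs′ → b ∈ ys′ → Separated a b)
    separate m xs ys sepx sepy hx hy =
      let xs₁ , ys₁ , xs₁⊆ , ys₁⊆ , hx₁ , hy₁ , xy = halve (m + m) xs ys sepy hx hy
          ys₂ , xs₂ , ys₂⊆ , xs₂⊆ , hy₂ , hx₂ , yx =
            halve m ys₁ xs₁ (AllPairs-resp-⊆ xs₁⊆ sepx) hy₁ hx₁
      in xs₂ , ys₂ , ⊆-trans xs₂⊆ xs₁⊆ , ⊆-trans ys₂⊆ ys₁⊆ , hx₂ , hy₂ , λ {_} {_} a∈ b∈ meet →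
           [ xy (lookup xs₂⊆ a∈) (lookup ys₂⊆ b∈) , yx b∈ a∈ ]′ (meet⇒enters meet)

  -- Sets with a convex trace on each of several levels.

  module Levels {Λ : Set b} (O : Λ → TotalPreorder a ℓ₁ ℓ₂) {I : Set c}
    (A : I → ∀ l → Pred (TotalPreorder.Carrier (O l)) ℓ)
    (convex : ∀ i l {x y z} → TotalPreorder._≲_ (O l) x y → TotalPreorder._≲_ (O l) y z →
      A i l x → A i l z → A i l y)
    where

    open module OnLevel l = Line (O l) (λ i → A i l) (λ i → convex i l)
      using (_⊴_; ⊴-total; ⊴-trans; common-point; separate)

    Point : Set _
    Point = Σ[ l ∈ Λ ] TotalPreorder.Carrier (O l)

    Separated : List Λ → Rel I _
    Separated J a b = All (λ l → ¬ A a l ≬ A b l) J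

    Separated-sym : ∀ {J a b} → Separated J a b → Separated J b a
    Separated-sym = All.map λ ¬ab (x , x∈b , x∈a) → ¬ab (x , x∈a , x∈b)

    -- The levels are treated one after another, at a factor of four each; disjointness on a level
    -- already treated survives the passage to sublists.
    separate-pair : ∀ J m → ∃ λ M → ∀ xs ys →
      AllPairs (Separated J) xs → AllPairs (Separated J) ys → M ≤ length xs → M ≤ length ys →
      ∃₂ λ xs′ ys′ → xs′ ⊆ xs × ys′ ⊆ ys × m ≤ length xs′ × m ≤ length ys′ ×
        (∀ {a b} → a ∈ xs′ → b ∈ ys′ → Separated J a b)
    separate-pair [] m = m , λ xs ys _ _ hx hy → xs , ys , ⊆-refl , ⊆-refl , hx , hy , λ _ _ → []
    separate-pair (l ∷ J) m with separate-pair J m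
    ... | M , IH = (M + M) + (M + M) , λ xs ys sepx sepy hx hy →
      let xs₁ , ys₁ , xs₁⊆ , ys₁⊆ , hx₁ , hy₁ , sep =
            separate l M xs ys (AllPairs.map All.head sepx) (AllPairs.map All.head sepy) hx hy
          xs₂ , ys₂ , xs₂⊆ , ys₂⊆ , hx₂ , hy₂ , sep′ =
            IH xs₁ ys₁ (AllPairs-resp-⊆ xs₁⊆ (AllPairs.map All.tail sepx))
              (AllPairs-resp-⊆ ys₁⊆ (AllPairs.map All.tail sepy)) hx₁ hy₁
      in xs₂ , ys₂ , ⊆-trans xs₂⊆ xs₁⊆ , ⊆-trans ys₂⊆ ys₁⊆ , hx₂ , hy₂ , λ {_} {_} a∈ b∈ →
           sep (lookup xs₂⊆ a∈) (lookup ys₂⊆ b∈) ∷ sep′ a∈ b∈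

    separate-one : ∀ J k m → ∃ λ M → ∀ xs (D : Fin k → List I) →
      AllPairs (Separated J) xs → (∀ i → AllPairs (Separated J) (D i)) →
      M ≤ length xs → (∀ i → M ≤ length (D i)) →
      Σ[ xs′ ∈ List I ] Σ[ E ∈ (Fin k → List I) ] xs′ ⊆ xs × (∀ i → E i ⊆ D i) ×
        m ≤ length xs′ × (∀ i → m ≤ length (E i)) ×
        (∀ i {a b} → a ∈ xs′ → b ∈ E i → Separated J a b)
    separate-one J zero m = m , λ xs D _ _ hx _ → xs , D , ⊆-refl , (λ ()) , hx , (λ ()) , λ ()
    separate-one J (suc k) m with separate-one J k m
    -- What remains of `xs` must have length `M` to be separated from the later lists, while the
    -- sublist of `D zero` is final and must have length `m`; hence the maximum.
    ... | M , IH with separate-pair J (M ⊔ m)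
    ...   | N , pair = M ⊔ N , λ xs D sepx sepD hx hD →
      let xs₁ , ys , xs₁⊆ , ys⊆ , hx₁ , hy , sep =
            pair xs (D zero) sepx (sepD zero) (≤-trans (m≤n⊔m M N) hx) (≤-trans (m≤n⊔m M N) (hD zero))
          xs₂ , E , xs₂⊆ , E⊆ , hx₂ , hE , sep′ =
            IH xs₁ (D ∘ suc) (AllPairs-resp-⊆ xs₁⊆ sepx) (sepD ∘ suc)
              (≤-trans (m≤m⊔n M m) hx₁) (λ i → ≤-trans (m≤m⊔n M N) (hD (suc i)))
      in xs₂ , (λ { zero → ys ; (suc i) → E i }) , ⊆-trans xs₂⊆ xs₁⊆ ,
         (λ { zero → ys⊆ ; (suc i) → E⊆ i }) , hx₂ ,
         (λ { zero → ≤-trans (m≤n⊔m M m) hy ; (suc i) → hE i }) ,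
         λ { zero a∈ b∈ → sep (lookup xs₂⊆ a∈) b∈ ; (suc i) a∈ b∈ → sep′ i a∈ b∈ }

    -- `separate-one` frees the first list from all others, and the induction then works among
    -- those, whose sublists inherit the separation from the first.
    separate-all : ∀ J k m → ∃ λ M → ∀ (D : Fin k → List I) →
      (∀ i → AllPairs (Separated J) (D i)) → (∀ i → M ≤ length (D i)) →
      Σ[ E ∈ (Fin k → List I) ] (∀ i → E i ⊆ D i) × (∀ i → m ≤ length (E i)) ×
        (∀ {i j} → i ≢ j → ∀ {a b} → a ∈ E i → b ∈ E j → Separated J a b)
    separate-all J zero m = 0 , λ D _ _ → D , (λ ()) , (λ ()) , λ { {()} }
    separate-all J (suc k) m with separate-all J k m
    ... | M , IH with separate-one J k (M ⊔ m)
    ...   | N , one = N , λ D sepD hD →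
      let xs , D₁ , xs⊆ , D₁⊆ , hx , hD₁ , sep = one (D zero) (D ∘ suc) (sepD zero) (sepD ∘ suc) (hD zero) (hD ∘ suc)
          E , E⊆ , hE , sep′ = IH D₁ (λ i → AllPairs-resp-⊆ (D₁⊆ i) (sepD (suc i)))
                                 (λ i → ≤-trans (m≤m⊔n M m) (hD₁ i))
      in (λ { zero → xs ; (suc i) → E i }) ,
         (λ { zero → xs⊆ ; (suc i) → ⊆-trans (E⊆ i) (D₁⊆ i) }) ,
         (λ { zero → ≤-trans (m≤n⊔m M m) hx ; (suc i) → hE i }) ,
         λ { {zero}  {zero}  i≢j → contradiction refl i≢j
           ; {zero}  {suc j} i≢j a∈ b∈ → sep j a∈ (lookup (E⊆ j) b∈)
           ; {suc i} {zero}  i≢j a∈ b∈ → Separated-sym (sep i b∈ (lookup (E⊆ i) a∈))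
           ; {suc i} {suc j} i≢j → sep′ (i≢j ∘ cong suc) }

    -- A set that is empty on the levels J may occur repeatedly in ws; this way the
    -- dichotomy below also covers families that cannot be pierced for that reason.
    Scattered : List Λ → ℕ → List I → Set _
    Scattered J p zs = ∃ λ ws → p ≤ length ws × All (_∈ zs) ws × AllPairs (Separated J) ws

    Pierced : ℕ → List I → Set _
    Pierced N zs = Σ[ s ∈ List Point ] length s ≤ N × (∀ {z} → z ∈ zs → Any (λ (l , x) → A z l x) s)

    -- The sweep along one level.

    module Gap (l : Λ) (J : List Λ) (M K : ℕ) (dichotomy : ∀ zs → Scattered J M zs ⊎ Pierced K zs) where

      infix 4 _≼_
      _≼_ : Rel I _
      _≼_ = _⊴_ l

      from : List I → I → List I
      from zs z = filter (all? (z ≼_)) zs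

      -- The condition for a cut. When it fails at `z`, the induction hypothesis `dichotomy` on the
      -- levels `J` pierces all sets starting no earlier than `z` by `K` points.
      Bad : List I → Pred I _
      Bad zs z = Scattered J M (from zs z)

      -- Let `v` start first among `us`. Applied once, beyond `v`, the induction hypothesis pierces
      -- all of `us`, so the bound `K` does not grow with the number of sets.
      good⇒pierced : ∀ zs us → (∀ {u} → u ∈ us → u ∈ zs) → (∀ {u} → u ∈ us → ¬ Bad zs u) → Pierced K us
      good⇒pierced zs []       _   _    = [] , z≤n , λ ()
      good⇒pierced zs (u ∷ us) us⊆ good with greatest {_R_ = flip _≼_} (flip (⊴-total l)) (flip (⊴-trans l)) u us
      ... | v , v∈ , vs with dichotomy (from zs v)
      ...   | inj₁ bad = contradiction bad (good v∈)
      ...   | inj₂ (s , s≤ , pierce) = s , s≤ , λ {w} w∈ →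
                pierce (∈-filter⁺ (all? (v ≼_)) (us⊆ w∈) (All.lookup vs w∈))

      start-pierced : ∀ z us → (∀ {u} → u ∈ us → u ≼ z × A z l ≬ A u l) → Pierced 1 us
      start-pierced z []       _ = [] , z≤n , λ ()
      start-pierced z (u ∷ us) h =
        let _ , _ , x∈z , _ = h (here refl)
            x , _ , x∈us = common-point l z (u ∷ us) x∈z h
        in [ (l , x) ] , ≤-refl , λ w∈ → here (x∈us w∈)

      -- If w starts no later than z but misses it, then w lies entirely before z.
      before : ∀ {w z v} → w ≼ z → ¬ A z l ≬ A w l → z ≼ v → ¬ A v l ≬ A w l
      before {w} w≼z ¬zw z≼v (x , x∈v , x∈w) =
        let y , y∈z , y≲x = z≼v x∈v
            _ , u∈w , u≲y = w≼z y∈z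
        in ¬zw (y , y∈z , convex w l u≲y y≲x u∈w x∈w)

      Groups : ℕ → List I → Set _
      Groups t zs = Σ[ D ∈ (Fin t → List I) ]
        (∀ i → M ≤ length (D i) × All (_∈ zs) (D i) × AllPairs (Separated J) (D i)) ×
        (∀ {i j} → i ≢ j → ∀ {a b} → a ∈ D i → b ∈ D j → ¬ A a l ≬ A b l)

      -- Cut at the last-starting bad `z`. Sets starting after `z` are good and are pierced by `K`
      -- points; those entered by `z` are pierced by one more. By `before`, the others miss every
      -- set starting no earlier than `z`, hence the whole group found there, and the sweep
      -- continues among them. Each cut thus costs `K + 1` points and the last piece `K`.
      groups : ∀ t zs → Groups t zs ⊎ Pierced (t * (K + 1) + K) zs
      groups zero    zs = inj₁ ((λ ()) , (λ ()) , λ { {()} })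
      groups (suc t) zs with filter (all? (Bad zs)) zs in eq
      ... | [] = inj₂ (
              let s , s≤ , pierce = good⇒pierced zs zs id λ u∈ bad →
                    ¬∈[] (subst (_ ∈_) eq (∈-filter⁺ (all? (Bad zs)) u∈ bad))
              in s , ≤-trans s≤ (ℕ.m≤n+m K _) , pierce)
        where
        ¬∈[] : ∀ {u} → ¬ u ∈ []
        ¬∈[] ()
      ... | z₀ ∷ bads with greatest {_R_ = _≼_} (⊴-total l) (⊴-trans l) z₀ bads
      ...   | z , z∈ , zs≼z = result (groups t low)
        where
        rest = filter (all? (_≼ z)) zs
        late = filter (¬? ∘ all? (_≼ z)) zs
        low  = filter (¬? ∘ all? (λ w → A z l ≬ A w l)) rest
        mid  = filter (all? (λ w → A z l ≬ A w l)) rest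

        z-bad : Bad zs z
        z-bad = proj₂ (∈-filter⁻ (all? (Bad zs)) {xs = zs} (subst (z ∈_) (sym eq) z∈))

        low⁻ : ∀ {w} → w ∈ low → w ∈ zs × w ≼ z × ¬ A z l ≬ A w l
        low⁻ w∈ =
          let w∈rest , miss = ∈-filter⁻ (¬? ∘ all? (λ w → A z l ≬ A w l)) {xs = rest} w∈
              w∈zs , w≼z = ∈-filter⁻ (all? (_≼ z)) {xs = zs} w∈rest
          in w∈zs , w≼z , miss

        late-pierced : Pierced K late
        late-pierced = good⇒pierced zs late (λ u∈ → proj₁ (late⁻ u∈)) λ {u} u∈ bad →
          proj₂ (late⁻ u∈) (All.lookup zs≼z (subst (u ∈_) eq (∈-filter⁺ (all? (Bad zs)) (proj₁ (late⁻ u∈)) bad)))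
          where
          late⁻ : ∀ {u} → u ∈ late → u ∈ zs × ¬ u ≼ z
          late⁻ = ∈-filter⁻ (¬? ∘ all? (_≼ z)) {xs = zs}

        mid-pierced : Pierced 1 mid
        mid-pierced = start-pierced z mid λ u∈ →
          let u∈rest , meet = ∈-filter⁻ (all? (λ w → A z l ≬ A w l)) {xs = rest} u∈
          in proj₂ (∈-filter⁻ (all? (_≼ z)) {xs = zs} u∈rest) , meet

        result : Groups t low ⊎ Pierced (t * (K + 1) + K) low → _
        result (inj₁ (D , hD , sep)) = inj₁ (
          (λ { zero → proj₁ z-bad ; (suc i) → D i }) ,
          (λ { zero → let _ , M≤ , ∈from , sepJ = z-bad in
                      M≤ , All.map (proj₁ ∘ ∈-filter⁻ (all? (z ≼_)) {xs = zs}) ∈from , sepJ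
             ; (suc i) → let M≤ , ∈low , sepJ = hD i in M≤ , All.map (proj₁ ∘ low⁻) ∈low , sepJ }) ,
          λ { {zero}  {zero}  i≢j → contradiction refl i≢j
            ; {zero}  {suc j} _ a∈ b∈ → first-before j a∈ b∈
            ; {suc i} {zero}  _ a∈ b∈ (x , x∈a , x∈b) → first-before i b∈ a∈ (x , x∈b , x∈a)
            ; {suc i} {suc j} i≢j → sep (i≢j ∘ cong suc) })
          where
          first-before : ∀ j {a b} → a ∈ proj₁ z-bad → b ∈ D j → ¬ A a l ≬ A b l
          first-before j a∈ b∈ =
            let _ , _ , ∈from , _ = z-bad
                _ , b≼z , miss = low⁻ (All.lookup (proj₁ (proj₂ (hD j))) b∈)
            in before b≼z miss (proj₂ (∈-filter⁻ (all? (z ≼_)) {xs = zs} (All.lookup ∈from a∈)))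
        result (inj₂ (s , s≤ , pierce)) =
          let s₁ , s₁≤ , pierce₁ = late-pierced
              s₂ , s₂≤ , pierce₂ = mid-pierced
          in inj₂ (s₁ ++ (s₂ ++ s) ,
            (begin
              length (s₁ ++ (s₂ ++ s))          ≡⟨ length-++ s₁ ⟩
              length s₁ + length (s₂ ++ s)      ≡⟨ cong (length s₁ ℕ.+_) (length-++ s₂) ⟩
              length s₁ + (length s₂ + length s) ≡⟨ ℕ.+-assoc (length s₁) _ _ ⟨
              length s₁ + length s₂ + length s  ≤⟨ ℕ.+-mono-≤ (ℕ.+-mono-≤ s₁≤ s₂≤) s≤ ⟩
              K + 1 + (t * (K + 1) + K)         ≡⟨ ℕ.+-assoc (K + 1) _ _ ⟨
              suc t * (K + 1) + K               ∎) ,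
            λ {w} w∈ → case w w∈ pierce₁ pierce₂)
          where
          open ≤-Reasoning
          case : ∀ w → w ∈ zs → ∀ {s₁ s₂} →
            (∀ {z} → z ∈ late → Any (λ (l , x) → A z l x) s₁) →
            (∀ {z} → z ∈ mid → Any (λ (l , x) → A z l x) s₂) →
            Any (λ (l , x) → A w l x) (s₁ ++ (s₂ ++ s))
          case w w∈ {s₁} {s₂} p₁ p₂ with dec (w ≼ z)
          ... | no ¬w≼z = Any.++⁺ˡ (p₁ (∈-filter⁺ (¬? ∘ all? (_≼ z)) w∈ ¬w≼z))
          ... | yes w≼z with dec (A z l ≬ A w l) | ∈-filter⁺ (all? (_≼ z)) w∈ w≼z
          ...   | yes meet | w∈rest = Any.++⁺ʳ s₁ (Any.++⁺ˡ (p₂ (∈-filter⁺ (all? (λ w → A z l ≬ A w l)) w∈rest meet)))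
          ...   | no ¬meet | w∈rest = Any.++⁺ʳ s₁ (Any.++⁺ʳ s₂ (pierce (∈-filter⁺ (¬? ∘ all? (λ w → A z l ≬ A w l)) w∈rest ¬meet)))

    scattered-or-pierced : ∀ J p → ∃ λ N → ∀ zs → Scattered J p zs ⊎ Pierced N zs
    scattered-or-pierced [] p = 0 , λ where
      []       → inj₂ ([] , z≤n , λ ())
      -- With no levels left, separation is vacuous, so `p` copies of one member are scattered.
      (z ∷ zs) → inj₁ (tabulate {n = p} (λ _ → z) , ≤-reflexive (sym (length-tabulate {n = p} (λ _ → z))) ,
                       All.tabulate⁺ {n = p} (λ _ → here refl) , AllPairs.tabulate⁺ {n = p} (λ _ → []))
    -- One set per group is enough: different groups are already disjoint on `l`, and thinning them
    -- makes their members disjoint on `J` too. `M` is the group size that this thinning demands.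
    scattered-or-pierced (l ∷ J) p with separate-all J p 1
    ... | M , select with scattered-or-pierced J M
    ...   | K , IH = p * (K + 1) + K , λ zs → Sum.map₁ (scatter zs) (groups p zs)
      where
      open Gap l J M K IH
      head : ∀ {xs : List I} → 1 ≤ length xs → ∃ (_∈ xs)
      head {_ ∷ _} _ = _ , here refl
      scatter : ∀ zs → Groups p zs → Scattered (l ∷ J) p zs
      scatter zs (D , hD , sep) =
        let E , E⊆ , hE , sep′ = select D (λ i → proj₂ (proj₂ (hD i))) (λ i → proj₁ (hD i))
            w = λ i → head (hE i)
        in tabulate (proj₁ ∘ w) , ≤-reflexive (sym (length-tabulate (proj₁ ∘ w))) ,
           All.tabulate⁺ (λ i → All.lookup (proj₁ (proj₂ (hD i))) (lookup (E⊆ i) (proj₂ (w i)))) ,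
           AllPairs.tabulate⁺ λ {i} {j} i≢j →
             sep i≢j (lookup (E⊆ i) (proj₂ (w i))) (lookup (E⊆ j) (proj₂ (w j))) ∷
             sep′ i≢j (proj₂ (w i)) (proj₂ (w j))

  -- Least witnesses, the pigeonhole principle and totality of the real order.

  least : {Q : Pred ℕ ℓ} → ∀ b {n} → n ≤ b → Q n → LeastAtMost Q b
  least {Q = Q} b {n} n≤b q = go n n n≤b ℕ.≤-refl q
    where
    go : ∀ k n → n ≤ b → n ≤ k → Q n → LeastAtMost Q b
    go k n n≤b n≤k q with dec (∃ λ m → m ℕ.< n × Q m)
    ... | no ¬m = n , (q , λ m qm → ℕ.≮⇒≥ λ m<n → ¬m (m , m<n , qm)) , n≤b
    go zero    n n≤b z≤n q | yes (_ , () , _)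
    go (suc k) n n≤b n≤k q | yes (m , m<n , qm) =
      go k m (ℕ.≤-trans (ℕ.<⇒≤ m<n) n≤b) (ℕ.≤-pred (ℕ.≤-trans m<n n≤k)) qm

  module _ {X : Set a} {L : Set b} (f : X → L) where

    fiber : L → List X → List X
    fiber c = filter (all? (λ x → f x ≡ c))

    length-by-fibers : ∀ t cs xs → All (λ x → f x ∈ cs) xs → (∀ c → length (fiber c xs) ≤ t) →
      length xs ≤ length cs * t
    length-by-fibers t []       []      _        _ = z≤n
    length-by-fibers t []       (_ ∷ _) (() ∷ _) _
    length-by-fibers t (c ∷ cs) xs      xs∈      h = ℕ.≤-trans
      (ℕ.≤-reflexive (sym (length-filter-split c? xs)))
      (ℕ.+-mono-≤ (h c) (length-by-fibers t cs others
        (All.tabulate λ {x} x∈ → let x∈xs , fx≢c = ∈-filter⁻ (¬? ∘ c?) {xs = xs} x∈ in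
          Any.tail fx≢c (All.lookup xs∈ x∈xs))
        λ c′ → ℕ.≤-trans (length-mono-≤ (filter-mono-⊆ (all? _) (all? _) (λ { refl → id })
                 (filter-⊆ (¬? ∘ c?) xs))) (h c′)))
      where
      c? = all? (λ x → f x ≡ c)
      others = filter (¬? ∘ c?) xs

  -- The pigeonhole principle, used for Radon with the levels as holes and for fractional Helly with
  -- the pairs of a set and a level.
  length≤fibers : {X : Set a} {M : ℕ} (f : X → Fin M) (t : ℕ) (xs : List X) →
    (∀ c → length (fiber f c xs) ≤ t) → length xs ≤ M * t
  length≤fibers {M = M} f t xs h = subst (λ k → length xs ≤ k * t) (length-tabulate {n = M} id)
    (length-by-fibers f t (allFin M) xs (All.tabulate λ _ → ∈-allFin _) h)

  -- A rational below `x` but not below `y` exceeds every rational below `y`, so all of these belong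
  -- to the cut of `x`.
  ≤ᴿ-total : Total Defs._≤_
  ≤ᴿ-total x y with dec (x Defs.≤ y)
  ... | yes x≤y = inj₁ x≤y
  ... | no ¬x≤y = inj₂ λ {r} r∈y →
    let q , ¬imp = ¬∀⇒∃¬ {Q = λ q → ℝ.lower x q → ℝ.lower y q} λ f → ¬x≤y (f _)
        q∈x = stable λ q∉x → ¬imp λ q∈x → contradiction q∈x q∉x
        q∉y = λ q∈y → ¬imp λ _ → q∈y
    in ℝ.closed x (lower<upper y r∈y q∉y) q∈x

  -- Traces of d-intervals on `P`.

  module Traces {d : ℕ} (P : 𝒫 ℝ×[ d ]) where

    open Convexity ℝ×[ d ] P (𝒞≡ P)
    open Setoid ℝ×[ d ] using () renaming (_≈_ to _∼_; refl to ∼-refl; sym to ∼-sym; trans to ∼-trans)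

    -- Restricting the line to the points of `P` ensures that the common points found on it lie in
    -- `P`. It is only a preorder, as reals related by `≈` need not be identical.
    traceOrder : Fin d → TotalPreorder _ _ _
    traceOrder l = record
      { Carrier = ∃ λ x → ⟦ P ⟧ (x , l)
      ; _≈_ = λ x y → proj₁ x Defs.≈ proj₁ y
      ; _≲_ = λ x y → proj₁ x Defs.≤ proj₁ y
      ; isTotalPreorder = record
        { isPreorder = record
          { isEquivalence = record
            { refl  = λ {x} → Setoid.refl ℝ-setoid {proj₁ x}
            ; sym   = λ {x} {y} → Setoid.sym ℝ-setoid {proj₁ x} {proj₁ y}
            ; trans = λ {x} {y} {z} → Setoid.trans ℝ-setoid {proj₁ x} {proj₁ y} {proj₁ z}
            }
          ; reflexive = proj₁
          ; trans = λ x≤y y≤z p → y≤z (x≤y p)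
          }
        ; total = λ x y → ≤ᴿ-total (proj₁ x) (proj₁ y)
        }
      }

    ConvexSet : Set₁
    ConvexSet = Σ (𝒫 ℝ×[ d ]) (𝒞≡ P)

    trace : ConvexSet → ∀ l → Pred (TotalPreorder.Carrier (traceOrder l)) 0ℓ
    trace (K , _) l (x , _) = ⟦ K ⟧ (x , l)

    trace-convex : ∀ K l {x y z} → proj₁ x Defs.≤ proj₁ y → proj₁ y Defs.≤ proj₁ z →
      trace K l x → trace K l z → trace K l y
    trace-convex (K , I , to , from) l {y = _ , y∈P} x≤y y≤z x∈K z∈K =
      from (Interval.convex I l x≤y y≤z (proj₁ (to x∈K)) (proj₁ (to z∈K)) , y∈P)

    convex⊆P : ∀ (K : ConvexSet) {p} → ⟦ proj₁ K ⟧ p → ⟦ P ⟧ p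
    convex⊆P (K , I , to , from) p∈K = proj₂ (to p∈K)

    open module LineAt l = Line (traceOrder l) (λ K → trace K l) (λ K {x} {y} {z} → trace-convex K l {x} {y} {z})
      using (common-point; colorful-Helly; Enters; meet⇒enters)
    open Levels traceOrder trace trace-convex using (Separated; Separated-sym; separate-all; scattered-or-pierced; Scattered; Pierced)

    member : (ℱ : Family) → Fin (size ℱ) → ConvexSet
    member ℱ i = set ℱ i , convex ℱ i

    members : Family → List ConvexSet
    members ℱ = tabulate (member ℱ)

    separated-disjoint : ∀ K K′ → Separated (allFin d) K K′ → ∀ {p} → ⟦ proj₁ K ⟧ p → ¬ ⟦ proj₁ K′ ⟧ p
    separated-disjoint K _ sep {x , l} p∈K p∈K′ =
      All.lookup sep (∈-allFin l) ((x , convex⊆P K p∈K) , p∈K , p∈K′)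

    -- Radon numbers

    median : {X : Set} (f : X → ℝ) (Q : Pred X 0ℓ) → ∀ {i j k} → i ≢ j → i ≢ k → j ≢ k → Q i → Q j → Q k →
      ∃ λ u → ∃₂ λ v w → v ≢ u × v ≢ w × f u Defs.≤ f v × f v Defs.≤ f w × Q u × Q v × Q w
    median f Q {i} {j} {k} i≢j i≢k j≢k qi qj qk
      with ≤ᴿ-total (f i) (f j) | ≤ᴿ-total (f j) (f k) | ≤ᴿ-total (f i) (f k)
    ... | inj₁ ij | inj₁ jk | _       = i , j , k , i≢j ∘ sym , j≢k , ij , jk , qi , qj , qk
    ... | inj₁ ij | inj₂ kj | inj₁ ik = i , k , j , i≢k ∘ sym , j≢k ∘ sym , ik , kj , qi , qk , qj
    ... | inj₁ ij | inj₂ kj | inj₂ ki = k , i , j , i≢k , i≢j , ki , ij , qk , qi , qj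
    ... | inj₂ ji | _       | inj₁ ik = j , i , k , i≢j , i≢k , ji , ik , qj , qi , qk
    ... | inj₂ ji | inj₁ jk | inj₂ ki = j , k , i , j≢k ∘ sym , i≢k ∘ sym , jk , ki , qj , qk , qi
    ... | inj₂ ji | inj₂ kj | inj₂ ki = k , j , i , j≢k , i≢j ∘ sym , kj , ji , qk , qj , qi

    between : ∀ (K : ConvexSet) {l} {p q r : ℝ × Fin d} → proj₂ p ≡ l → proj₂ q ≡ l → proj₂ r ≡ l →
      proj₁ p Defs.≤ proj₁ q → proj₁ q Defs.≤ proj₁ r → ⟦ P ⟧ q →
      ⟦ proj₁ K ⟧ p → ⟦ proj₁ K ⟧ r → ⟦ proj₁ K ⟧ q
    between K {l} {p} {q} {r} refl refl refl p≤q q≤r q∈P p∈K r∈K =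
      trace-convex K l {proj₁ p , convex⊆P K p∈K} {proj₁ q , q∈P} {proj₁ r , convex⊆P K r∈K} p≤q q≤r p∈K r∈K

    -- Of `2d + 1` points some three share a level, and the middle one lies in the hull of the outer
    -- two. So `A` is that point alone and `B` the rest of `Y`.
    radon-upper : RadonProperty (2 * d + 1)
    radon-upper Y Y⊆P (f , f∈Y , f-inj) = split (stable ¬¬fiber)
      where
      level : Fin (2 * d + 1) → Fin d
      level = proj₂ ∘ f
      indices = allFin (2 * d + 1)
      fiberAt : Fin d → List (Fin (2 * d + 1))
      fiberAt l = fiber level l indices

      ¬¬fiber : ¬ ¬ ∃ λ l → 3 ≤ length (fiberAt l)
      ¬¬fiber ¬three = ℕ.<-irrefl refl (ℕ.<-≤-trans (ℕ.m<m+n (2 * d) (s≤s z≤n))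
        (subst₂ _≤_ (length-tabulate {n = 2 * d + 1} id) (ℕ.*-comm d 2)
          (length≤fibers level 2 indices λ l → ℕ.≤-pred (ℕ.≰⇒> λ 3≤ → ¬three (l , 3≤)))))

      split : (∃ λ l → 3 ≤ length (fiberAt l)) → Σ[ A ∈ 𝒫 ℝ×[ d ] ] Σ[ B ∈ 𝒫 ℝ×[ d ] ]
        ⟦ A ⟧ Unary.∪ ⟦ B ⟧ ≐ ⟦ Y ⟧ × ⟦ A ⟧ Unary.⊥ ⟦ B ⟧ × conv A ≬ conv B
      split (l , 3≤) with fiberAt l | Unique.filter⁺ (all? (λ i → level i ≡ l)) (Unique.allFin⁺ (2 * d + 1))
                        | All.all-filter (all? (λ i → level i ≡ l)) indices
      split (l , s≤s (s≤s (s≤s _))) | i ∷ j ∷ k ∷ _ | (i≢j ∷ i≢k ∷ _) ∷ (j≢k ∷ _) ∷ _ | i-l ∷ j-l ∷ k-l ∷ _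
        with median (proj₁ ∘ f) (λ i → level i ≡ l) i≢j i≢k j≢k i-l j-l k-l
      ... | u , v , w , v≢u , v≢w , u≤v , v≤w , u-l , v-l , w-l =
        A , B ,
        ((λ {p} → [ A⊆Y p , proj₁ ]′) , λ {p} p∈Y → case p p∈Y (dec (p ∼ f v))) ,
        (λ (p∼v , _ , p≁v) → p≁v p∼v) ,
        f v ,
        (λ K _ A⊆K → A⊆K (∼-refl {f v})) ,
        λ K K∈𝒞 B⊆K → between (K , K∈𝒞) u-l v-l w-l u≤v v≤w (Y⊆P (f∈Y v))
          (B⊆K (f∈Y u , λ u∼v → v≢u (sym (f-inj u∼v)))) (B⊆K (f∈Y w , λ w∼v → v≢w (sym (f-inj w∼v))))
        where
        A B : 𝒫 ℝ×[ d ]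
        A = record { ⟦_⟧ = _∼ f v ; resp = λ {p} {q} p∼q p∼v → ∼-trans {q} {p} {f v} (∼-sym {p} {q} p∼q) p∼v }
        B = record
          { ⟦_⟧  = λ p → ⟦ Y ⟧ p × ¬ p ∼ f v
          ; resp = λ {p} {q} p∼q (p∈Y , p≁v) → 𝒫.resp Y p∼q p∈Y , λ q∼v → p≁v (∼-trans {p} {q} {f v} p∼q q∼v)
          }
        A⊆Y : ∀ p → p ∼ f v → ⟦ Y ⟧ p
        A⊆Y p p∼v = 𝒫.resp Y (∼-sym {p} {f v} p∼v) (f∈Y v)
        case : ∀ p → ⟦ Y ⟧ p → Dec (p ∼ f v) → p ∼ f v ⊎ (⟦ Y ⟧ p × ¬ p ∼ f v)
        case p p∈Y (yes p∼v) = inj₁ p∼v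
        case p p∈Y (no p≁v)  = inj₂ (p∈Y , p≁v)

    -- Helly and colorful Helly numbers

    -- Two families are assigned to each level by `combine`. If no family intersects, the colorful
    -- Helly theorem on the line finds, for each level, members of its two families that are
    -- disjoint there. Together they form a choice with no common point on any level.
    colorful-helly-upper : Satisfiable ⟦ P ⟧ → ColorfulHellyProperty (2 * d)
    colorful-helly-upper (p₀ , p₀∈P) ℱ h with dec (∃ λ i → Intersects (ℱ i) Subset.⊤)
    ... | yes found = found
    ... | no ¬intersects = ⊥-elim (impossible (h (proj₁ ∘ choice)))
      where
      some : ∀ i → Fin (size (ℱ i))
      some i with size (ℱ i) in eq
      ... | suc _ = zero
      -- An empty family has intersection `P`, so `p₀` would make it intersect.
      ... | zero  = contradiction
              (i , p₀ , p₀∈P , λ j → contradiction (subst Fin eq j) λ ()) ¬intersects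

      index : ∀ i {K} → K ∈ member (ℱ i) (some i) ∷ members (ℱ i) → ∃ λ j → K ≡ member (ℱ i) j
      index i (here refl) = some i , refl
      index i (there K∈)  = ∈-tabulate⁻ K∈

      all-share : ∀ i l → (∃ λ x → ∀ {K} → K ∈ member (ℱ i) (some i) ∷ members (ℱ i) → trace K l x) →
        Intersects (ℱ i) Subset.⊤
      all-share i l ((x , x∈P) , x∈) = (x , l) , x∈P , λ j _ → x∈ (there (∈-tabulate⁺ {f = member (ℱ i)} j))

      disjoint-at : ∀ l → ∃₂ λ j k →
        ¬ trace (member (ℱ (combine {2} zero l)) j) l ≬ trace (member (ℱ (combine {2} (suc zero) l)) k) l
      disjoint-at l = stable λ ¬∃ →
        let i₀ = combine {2} zero l
            i₁ = combine {2} (suc zero) l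
        in [ (λ c → ¬intersects (i₀ , all-share i₀ l c)) , (λ c → ¬intersects (i₁ , all-share i₁ l c)) ]′
          (colorful-Helly l (member (ℱ i₀) (some i₀)) (members (ℱ i₀)) (member (ℱ i₁) (some i₁)) (members (ℱ i₁))
            λ {K} {K′} K∈ K′∈ → stable λ ¬meet →
              let j , K≡ = index i₀ K∈ ; k , K′≡ = index i₁ K′∈ in
              ¬∃ (j , k , subst₂ (λ K K′ → ¬ trace K l ≬ trace K′ l) K≡ K′≡ ¬meet))

      pick : ∀ s l → Fin (size (ℱ (combine {2} s l)))
      pick zero       l = proj₁ (disjoint-at l)
      pick (suc zero) l = proj₁ (proj₂ (disjoint-at l))

      -- `pick` is defined only at indices of the form `combine s l`, so a choice at every `i` comes
      -- by transport. The equation compares sets rather than indices because the type of a set does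
      -- not depend on the family.
      Choice : Fin (2 * d) → Set _
      Choice i = Σ[ c ∈ Fin (size (ℱ i)) ]
        (∀ s l → combine {2} s l ≡ i → set (ℱ i) c ≡ set (ℱ (combine {2} s l)) (pick s l))

      choice : ∀ i → Choice i
      choice i = subst Choice (combine-remQuot {2} d i) (at-pair (remQuot {2} d i))
        where
        at-pair : ∀ c → Choice (uncurry combine c)
        at-pair (s , l) = pick s l , λ s′ l′ eq → same s′ l′ (combine-injective s′ l′ s l eq)
          where
          same : ∀ s′ l′ → s′ ≡ s × l′ ≡ l →
            set (ℱ (combine {2} s l)) (pick s l) ≡ set (ℱ (combine {2} s′ l′)) (pick s′ l′)
          same _ _ (refl , refl) = refl

      impossible : ¬ ∃ λ x → ⟦ P ⟧ x × (∀ i → ⟦ set (ℱ i) (proj₁ (choice i)) ⟧ x)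
      impossible ((x , l) , x∈P , x∈) = proj₂ (proj₂ (disjoint-at l)) ((x , x∈P) , at zero , at (suc zero))
        where
        at : ∀ s → ⟦ set (ℱ (combine {2} s l)) (pick s l) ⟧ (x , l)
        at s = subst (λ K → ⟦ K ⟧ (x , l)) (proj₂ (choice (combine s l)) s l refl) (x∈ (combine s l))

    -- Give all `n` colors the same family: a choice then has at most `n` distinct members.
    colorful-helly⇒helly : ∀ {n} → ColorfulHellyProperty n → HellyProperty n
    colorful-helly⇒helly {n} ch ℱ h = proj₂ (ch (λ _ → ℱ) λ φ →
      let x , x∈P , x∈ = h (fromList (tabulate φ))
                           (ℕ.≤-trans (∣fromList∣≤length (tabulate φ)) (ℕ.≤-reflexive (length-tabulate φ)))
      in x , x∈P , λ i → x∈ (φ i) (∈-fromList⁺ (∈-tabulate⁺ i)))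

    helly-upper : HellyProperty (2 * d)
    helly-upper ℱ h with dec (Satisfiable ⟦ P ⟧)
    ... | yes sat = colorful-helly⇒helly (colorful-helly-upper sat) ℱ h
    -- For empty `P` even the empty subfamily fails to intersect, against the hypothesis.
    ... | no ¬sat = contradiction
            (let x , x∈P , _ = h Subset.⊥ (subst (_≤ 2 * d) (sym (Subset.∣⊥∣≡0 (size ℱ))) z≤n) in x , x∈P) ¬sat

    colorful-helly-least : LeastAtMost ColorfulHellyProperty (2 * d)
    colorful-helly-least with dec (Satisfiable ⟦ P ⟧)
    ... | yes sat = least {Q = ColorfulHellyProperty} (2 * d) ℕ.≤-refl (colorful-helly-upper sat)
    -- For empty `P` the value is `0`: with no colors the hypothesis already demands a point of `P`.
    ... | no ¬sat = least {Q = ColorfulHellyProperty} (2 * d) {0} z≤n λ ℱ h → contradiction (let x , x∈P , _ = h (λ ()) in x , x∈P) ¬sat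

    -- Lower bounds from two points in every level.

    module TwoPoints (two : TwoPointsInEveryLevel P) where

      ordered : ∀ l → ∃₂ λ x y → ¬ y Defs.≤ x × ⟦ P ⟧ (x , l) × ⟦ P ⟧ (y , l)
      ordered l with two l
      ... | x , y , x≉y , x∈P , y∈P with ≤ᴿ-total x y
      ...   | inj₁ x≤y = x , y , (λ y≤x → x≉y ((λ {q} → x≤y {q}) , λ {q} → y≤x {q})) , x∈P , y∈P
      ...   | inj₂ y≤x = y , x , (λ x≤y → x≉y ((λ {q} → x≤y {q}) , λ {q} → y≤x {q})) , y∈P , x∈P

      corner : Fin 2 × Fin d → ℝ
      corner (zero     , l) = proj₁ (ordered l)
      corner (suc zero , l) = proj₁ (proj₂ (ordered l))

      corner∈P : ∀ c → ⟦ P ⟧ (corner c , proj₂ c)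
      corner∈P (zero     , l) = proj₁ (proj₂ (proj₂ (proj₂ (ordered l))))
      corner∈P (suc zero , l) = proj₂ (proj₂ (proj₂ (proj₂ (ordered l))))

      low<high : ∀ l → ¬ corner (suc zero , l) Defs.≤ corner (zero , l)
      low<high l = proj₁ (proj₂ (proj₂ (ordered l)))

      opposite : Fin 2 × Fin d → Fin 2 × Fin d
      opposite (zero     , l) = suc zero , l
      opposite (suc zero , l) = zero , l

      side : Fin 2 × Fin d → Pred ℝ 0ℓ
      side c@(zero     , _) z = z Defs.≤ corner c
      side c@(suc zero , _) z = corner c Defs.≤ z

      -- The extremal family for Helly: a cut keeps all of `P` on the other levels and, on its own,
      -- only what lies outward from its corner. The two cuts of a level are disjoint there, while
      -- the opposite corner lies in every cut but this one.
      cut : Fin 2 × Fin d → ConvexSet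
      cut c = record
        { ⟦_⟧  = λ (z , i) → ⟦ P ⟧ (z , i) × (i ≡ proj₂ c → side c z)
        ; resp = λ { {z , i} {z′ , i} (z≈z′ , refl) (z∈P , h) →
                     𝒫.resp P {z , i} {z′ , i} (z≈z′ , refl) z∈P , λ i≡l → side-resp c {z} {z′} z≈z′ (h i≡l) }
        } ,
        record
        { level  = λ i z → i ≡ proj₂ c → side c z
        ; convex = λ i {x} {y} {z} x≤y y≤z hx hz i≡l → side-convex c {x} {y} {z} x≤y y≤z (hx i≡l) (hz i≡l)
        } ,
        swap , swap
        where
        side-resp : ∀ c {z z′} → z Defs.≈ z′ → side c z → side c z′
        side-resp (zero     , l) (_ , z′≤z) h = λ q∈ → h (z′≤z q∈)
        side-resp (suc zero , l) (z≤z′ , _) h = λ q∈ → z≤z′ (h q∈)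
        side-convex : ∀ c {x y z} → x Defs.≤ y → y Defs.≤ z → side c x → side c z → side c y
        side-convex (zero     , l) _ y≤z _ hz = λ q∈ → hz (y≤z q∈)
        side-convex (suc zero , l) x≤y _ hx _ = λ q∈ → x≤y (hx q∈)

      witness : Fin 2 × Fin d → ℝ × Fin d
      witness c = corner (opposite c) , proj₂ (opposite c)

      witness∉cut : ∀ c → ¬ ⟦ proj₁ (cut c) ⟧ (witness c)
      witness∉cut (zero     , l) (_ , h) = low<high l (h refl)
      witness∉cut (suc zero , l) (_ , h) = low<high l (h refl)

      witness∈cut : ∀ {c c′} → c ≢ c′ → ⟦ proj₁ (cut c′) ⟧ (witness c)
      witness∈cut {c} {c′} c≢c′ = corner∈P (opposite c) , on-side c c′ c≢c′
        where
        on-side : ∀ c c′ → c ≢ c′ → proj₂ (opposite c) ≡ proj₂ c′ → side c′ (corner (opposite c))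
        on-side (zero     , _) (zero     , _) c≢c′ refl = contradiction refl c≢c′
        on-side (zero     , _) (suc zero , _) c≢c′ refl = id
        on-side (suc zero , _) (zero     , _) c≢c′ refl = id
        on-side (suc zero , _) (suc zero , _) c≢c′ refl = contradiction refl c≢c′

      cuts : Family
      cuts = record
        { size     = 2 * d
        ; set      = λ i → proj₁ (cut (remQuot {2} d i))
        ; convex   = λ i → proj₂ (cut (remQuot {2} d i))
        ; distinct = λ {i} {j} (i⊆j , j⊆i) → remQuot-injective {2} d (stable λ i≢j →
                       witness∉cut (remQuot {2} d i) (j⊆i (witness∈cut i≢j)))
        }

      cuts-empty : ¬ Intersects cuts Subset.⊤
      cuts-empty ((z , l) , _ , z∈) = low<high l λ q∈ → z≤low (high≤z q∈)
        where
        z∈cut : ∀ s → ⟦ proj₁ (cut (s , l)) ⟧ (z , l)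
        z∈cut s = subst (λ c → ⟦ proj₁ (cut c) ⟧ (z , l)) (remQuot-combine s l)
          (z∈ (combine s l) Subset.∈⊤)
        z≤low : z Defs.≤ corner (zero , l)
        z≤low = proj₂ (z∈cut zero) refl
        high≤z : corner (suc zero , l) Defs.≤ z
        high≤z = proj₂ (z∈cut (suc zero)) refl

      -- Fewer than `2d` cuts omit some cut `i`, and the witness for `i` lies in all the others,
      -- although the cuts together have no common point.
      helly-lower : ∀ m → HellyProperty m → 2 * d ≤ m
      helly-lower m helly = ℕ.≮⇒≥ λ m<2d → cuts-empty (helly cuts λ T T≤m →
        let i , i∉T = ¬∀⇒∃¬ {Q = Subset._∈ T} λ full → ℕ.<-irrefl refl
              (ℕ.<-≤-trans (ℕ.≤-<-trans T≤m m<2d)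
                (subst (_≤ ∣ T ∣) (Subset.∣⊤∣≡n (2 * d)) (Subset.p⊆q⇒∣p∣≤∣q∣ {p = Subset.⊤} λ {i} _ → full i)))
        in witness (remQuot {2} d i) , corner∈P (opposite (remQuot {2} d i)) , λ j j∈T →
             witness∈cut λ i≡j → i∉T (subst (Subset._∈ T) (sym (remQuot-injective {2} d i≡j)) j∈T))

      colorful-helly-lower : ∀ m → ColorfulHellyProperty m → 2 * d ≤ m
      colorful-helly-lower m = helly-lower m ∘ colorful-helly⇒helly

      corners : 𝒫 ℝ×[ d ]
      corners = record
        { ⟦_⟧  = λ (z , l) → ∃ λ s → z Defs.≈ corner (s , l)
        ; resp = λ { {z , l} {z′ , l} ((z≤z′ , z′≤z) , refl) (s , z≤c , c≤z) →
                     s , (λ q∈ → z≤c (z′≤z q∈)) , λ q∈ → z≤z′ (c≤z q∈) }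
        }

      -- All of `P` on the other levels is included, so that containing a given subset of `P` is a
      -- condition on level `l` alone.
      singleton-at : ℝ → Fin d → ConvexSet
      singleton-at x l = record
        { ⟦_⟧  = λ (z , i) → ⟦ P ⟧ (z , i) × (i ≡ l → z Defs.≈ x)
        ; resp = λ { {z , i} {z′ , i} z∼z′@((z≤z′ , z′≤z) , refl) (z∈P , h) →
                     𝒫.resp P {z , i} {z′ , i} z∼z′ z∈P ,
                     λ i≡l → (λ q∈ → proj₁ (h i≡l) (z′≤z q∈)) , λ q∈ → z≤z′ (proj₂ (h i≡l) q∈) }
        } ,
        record
        { level  = λ i z → i ≡ l → z Defs.≈ x
        ; convex = λ i u≤v v≤w hu hw i≡l → (λ q∈ → proj₁ (hw i≡l) (v≤w q∈)) , λ q∈ → u≤v (proj₂ (hu i≡l) q∈)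
        } ,
        swap , swap

      -- For `m ≤ 2d` the property would apply to the set of all corners, which has at least `m`
      -- points; `separate` shows that no partition of it works.
      radon-lower : ∀ m → RadonProperty m → 2 * d + 1 ≤ m
      radon-lower m radon = ℕ.≮⇒≥ λ m<2d+1 →
        let m≤2d = ℕ.≤-pred (subst (suc m ≤_) (ℕ.+-comm (2 * d) 1) m<2d+1)
            c    = λ i → remQuot {2} d (inject≤ i m≤2d)
            A , B , A∪B≐Y , A⊥B , (z , l) , z∈A , z∈B = radon corners corners⊆P
              ( (λ i → corner (c i) , proj₂ (c i))
              , (λ i → proj₁ (c i) , Setoid.refl ℝ-setoid {corner (c i)})
              , λ {i} {j} i∼j → inject≤-injective m≤2d m≤2d i j
                  (remQuot-injective {2} d (corner-injective (c i) (c j) i∼j)))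
        in separate A B A∪B≐Y A⊥B z∈A z∈B
        where
        corners⊆P : ⟦ corners ⟧ Unary.⊆ ⟦ P ⟧
        corners⊆P {z , l} (s , z≈c) =
          𝒫.resp P {corner (s , l) , l} {z , l} (swap z≈c , refl) (corner∈P (s , l))

        corner-injective : ∀ c c′ → (corner c , proj₂ c) ∼ (corner c′ , proj₂ c′) → c ≡ c′
        corner-injective (zero     , l) (zero     , l) (_ , refl) = refl
        corner-injective (zero     , l) (suc zero , l) ((_ , ≥) , refl) = contradiction (λ {q} → ≥ {q}) (low<high l)
        corner-injective (suc zero , l) (zero     , l) ((≤ , _) , refl) = contradiction (λ {q} → ≤ {q}) (low<high l)
        corner-injective (suc zero , l) (suc zero , l) (_ , refl) = refl

        -- Without its corner on side `s`, `Z` can contain only the opposite corner on level `l`; so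
        -- `K` contains `Z` and hence its hull.
        opposite-only : ∀ {Z z l} → ⟦ Z ⟧ Unary.⊆ ⟦ corners ⟧ → conv Z (z , l) →
          ∀ s → ¬ ⟦ Z ⟧ (corner (s , l) , l) → z Defs.≈ corner (opposite (s , l))
        opposite-only {Z} {z} {l} Z⊆Y z∈Z s c∉Z =
          proj₂ (z∈Z (proj₁ K) (proj₂ K) Z⊆K) refl
          where
          K = singleton-at (corner (opposite (s , l))) l
          other : ∀ s s′ {y} → ⟦ Z ⟧ (y , l) → ¬ ⟦ Z ⟧ (corner (s , l) , l) → y Defs.≈ corner (s′ , l) →
            y Defs.≈ corner (opposite (s , l))
          other zero       zero       {y} y∈Z c∉Z y≈c = contradiction (𝒫.resp Z {y , l} (y≈c , refl) y∈Z) c∉Z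
          other zero       (suc zero) y∈Z c∉Z y≈c = y≈c
          other (suc zero) zero       y∈Z c∉Z y≈c = y≈c
          other (suc zero) (suc zero) {y} y∈Z c∉Z y≈c = contradiction (𝒫.resp Z {y , l} (y≈c , refl) y∈Z) c∉Z
          Z⊆K : ⟦ Z ⟧ Unary.⊆ ⟦ proj₁ K ⟧
          Z⊆K {y , i} y∈Z = corners⊆P (Z⊆Y y∈Z) , λ { refl → let s′ , y≈c = Z⊆Y y∈Z in other s s′ y∈Z c∉Z y≈c }

        -- Each corner of level `l` is missing from `A` or from `B`, which forces `z` to be the
        -- opposite corner. Applied to both corners, this would identify them.
        separate : ∀ A B → ⟦ A ⟧ Unary.∪ ⟦ B ⟧ ≐ ⟦ corners ⟧ → ⟦ A ⟧ Unary.⊥ ⟦ B ⟧ → ∀ {z l} →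
          conv A (z , l) → ¬ conv B (z , l)
        separate A B (A∪B⊆Y , _) A⊥B {z} {l} z∈A z∈B =
          low<high l λ q∈ → proj₁ (near (suc zero)) (proj₂ (near zero) q∈)
          where
          near : ∀ s → (z Defs.≤ corner (opposite (s , l))) × (corner (opposite (s , l)) Defs.≤ z)
          near s with dec (⟦ A ⟧ (corner (s , l) , l))
          ... | no c∉A = opposite-only {A} (A∪B⊆Y ∘ inj₁) z∈A s c∉A
          ... | yes c∈A = opposite-only {B} (A∪B⊆Y ∘ inj₂) z∈B s λ c∈B → A⊥B (c∈A , c∈B)

    -- (p,q) theorems

    -- Separation refers to positions rather than to sets, because a scattered list may repeat a
    -- set.
    select : ∀ (ℱ : Family) {p E} → p ≤ length E → (∀ {K} → K ∈ E → K ∈ members ℱ) →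
      Σ[ φ ∈ (Fin p → Fin (size ℱ)) ] (∀ a → member ℱ (φ a) ∈ E) ×
        (∀ {J} → AllPairs (Separated J) E → ∀ {a b} → a ≢ b → Separated J (member ℱ (φ a)) (member ℱ (φ b)))
    select ℱ {p} {E} p≤ E⊆ =
      (λ a → proj₁ (index a)) ,
      (λ a → subst (_∈ E) (proj₂ (index a)) (∈-lookup (inject≤ a p≤))) ,
      λ {J} sep {a} {b} a≢b → subst₂ (Separated J) (proj₂ (index a)) (proj₂ (index b))
        (AllPairs-lookup (λ {K} {K′} → Separated-sym {J} {K} {K′}) sep (a≢b ∘ inject≤-injective p≤ p≤ a b))
      where
      index : ∀ a → ∃ λ i → List.lookup E (inject≤ a p≤) ≡ member ℱ i
      index a = ∈-tabulate⁻ (E⊆ (∈-lookup (inject≤ a p≤)))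

    -- A set occurring at two positions would be disjoint from itself, which a nonempty set is not.
    separated⇒injective : ∀ (ℱ : Family) → NonemptyMembers ℱ → ∀ {p} (φ : Fin p → Fin (size ℱ)) →
      (∀ {a b} → a ≢ b → Separated (allFin d) (member ℱ (φ a)) (member ℱ (φ b))) → Injective _≡_ _≡_ φ
    separated⇒injective ℱ nonempty φ sep {a} {b} Ca≡Cb = stable λ a≢b →
      let x , x∈ = nonempty (φ a) in
      separated-disjoint (member ℱ (φ a)) (member ℱ (φ b)) (sep a≢b) x∈ (subst (λ i → ⟦ set ℱ i ⟧ x) Ca≡Cb x∈)

    pierced⇒pierceable : ∀ {N} (ℱ : Family) → Pierced N (members ℱ) → Pierceable N ℱ
    pierced⇒pierceable {N} ℱ (s , s≤N , pierce) =
      map (λ (l , x , _) → x , l) s ,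
      subst (_≤ N) (sym (length-map _ s)) s≤N ,
      All.map⁺ (All.universal (λ (_ , _ , x∈P) → x∈P) s) ,
      λ i → Any.map⁺ (pierce (∈-tabulate⁺ {f = member ℱ} i))

    -- A scattered list would give `p` pairwise disjoint members, distinct because nonempty, among
    -- which no `q ≥ 2` meet; so the dichotomy leaves only piercing.
    pq : ∀ p q → 2 ≤ q → PQTheorem p q
    pq p q 2≤q with scattered-or-pierced (allFin d) p
    ... | N , dichotomy = N , λ ℱ nonempty h →
        [ (λ scattered → ⊥-elim (contra ℱ nonempty h scattered)) , pierced⇒pierceable ℱ ]′ (dichotomy (members ℱ))
      where
      contra : ∀ (ℱ : Family) → NonemptyMembers ℱ →
        (∀ T → ∣ T ∣ ≡ p → ∃ λ U → U Subset.⊆ T × ∣ U ∣ ≡ q × Intersects ℱ U) →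
        ¬ Scattered (allFin d) p (members ℱ)
      contra ℱ nonempty h (E , p≤ , E⊆ , sep) =
        let φ , _ , φ-sep = select ℱ p≤ (All.lookup E⊆)
            separated = λ {a} {b} → φ-sep sep {a} {b}
            φ-inj = separated⇒injective ℱ nonempty φ separated
            T = fromList (tabulate φ)
            ∣T∣≡p = ℕ.≤-antisym
              (subst (∣ T ∣ ≤_) (length-tabulate φ) (∣fromList∣≤length (tabulate φ)))
              (subst (_≤ ∣ T ∣) (length-tabulate φ)
                (unique⇒length≤∣p∣ (tabulate φ) (Unique.tabulate⁺ φ-inj) (All.tabulate ∈-fromList⁺)))
            U , U⊆T , ∣U∣≡q , x , _ , x∈ = h T ∣T∣≡p
            i , j , i≢j , i∈U , j∈U = 1<∣p∣⇒distinct U (subst (2 ≤_) (sym ∣U∣≡q) 2≤q)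
            a , i≡Ca = ∈-tabulate⁻ (∈-fromList⁻ (tabulate φ) (U⊆T i∈U))
            b , j≡Cb = ∈-tabulate⁻ (∈-fromList⁻ (tabulate φ) (U⊆T j∈U))
        in separated-disjoint (member ℱ (φ a)) (member ℱ (φ b))
             (separated {a} {b} λ a≡b → i≢j (trans i≡Ca (trans (cong φ a≡b) (sym j≡Cb))))
             (subst (λ i → ⟦ set ℱ i ⟧ x) i≡Ca (x∈ i i∈U))
             (subst (λ i → ⟦ set ℱ i ⟧ x) j≡Cb (x∈ j j∈U))

    CrossSeparated : ∀ {k} → (Fin k → Family) → ℕ → Set _
    CrossSeparated {k} ℱ m = Σ[ φ ∈ (∀ i → Fin m → Fin (size (ℱ i))) ]
      (∀ i {a b} → a ≢ b → Separated (allFin d) (member (ℱ i) (φ i a)) (member (ℱ i) (φ i b))) ×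
      (∀ {i j} → i ≢ j → ∀ a b → Separated (allFin d) (member (ℱ i) (φ i a)) (member (ℱ j) (φ j b)))

    -- If no family can be pierced by `N` points, each contains a scattered list long enough for
    -- `separate-all` to leave `m` sets in each, disjoint also across families.
    cross-separated-or-pierceable : ∀ k m → ∃ λ N → ∀ (ℱ : Fin k → Family) →
      CrossSeparated ℱ m ⊎ ∃ λ i → Pierceable N (ℱ i)
    cross-separated-or-pierceable k m with separate-all (allFin d) k m
    ... | M , separate with scattered-or-pierced (allFin d) M
    ...   | N , dichotomy = N , choose
      where
      choose : ∀ (ℱ : Fin k → Family) → CrossSeparated ℱ m ⊎ ∃ λ i → Pierceable N (ℱ i)
      choose ℱ with dec (∃ λ i → Pierceable N (ℱ i))
      ... | yes pierceable = inj₂ pierceable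
      ... | no ¬pierceable = inj₁
            ( (λ i → proj₁ (φ i))
            , (λ i → proj₂ (proj₂ (φ i)) (AllPairs-resp-⊆ (E⊆ i) (proj₂ (proj₂ (proj₂ (scattered i))))))
            , λ i≢j a b → sep i≢j (proj₁ (proj₂ (φ _)) a) (proj₁ (proj₂ (φ _)) b))
        where
        scattered : ∀ i → Scattered (allFin d) M (members (ℱ i))
        scattered i = [ id , (λ pierced → contradiction (i , pierced⇒pierceable (ℱ i) pierced) ¬pierceable) ]′
                        (dichotomy (members (ℱ i)))
        separation = separate (λ i → proj₁ (scattered i)) (λ i → proj₂ (proj₂ (proj₂ (scattered i))))
                       (λ i → proj₁ (proj₂ (scattered i)))
        E   = proj₁ separation
        E⊆  = proj₁ (proj₂ separation)
        m≤E = proj₁ (proj₂ (proj₂ separation))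
        sep = proj₂ (proj₂ (proj₂ separation))
        φ : ∀ i → _
        φ i = select (ℱ i) (m≤E i) λ K∈ →
          All.lookup (proj₁ (proj₂ (proj₂ (scattered i)))) (lookup (E⊆ i) K∈)

    -- With `p` cross-separated sets per family, the hypothesis yields one from each with a common
    -- point; as `q ≥ 2`, those from the first two families contradict disjointness.
    colorful-pq₁ : ∀ p q → 2 ≤ q → ColorfulPQTheorem₁ p q
    colorful-pq₁ p q@(suc (suc _)) (s≤s (s≤s _)) with cross-separated-or-pierceable q p
    ... | N , dichotomy = N , λ ℱ nonempty h → [ (λ (φ , within , across) →
        let j , x , _ , x∈ = h φ (λ i → separated⇒injective (ℱ i) (nonempty i) (φ i) (within i))
            K = λ i → member (ℱ i) (φ i (j i))
        in ⊥-elim (separated-disjoint (K zero) (K (suc zero))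
             (across (λ ()) (j zero) (j (suc zero))) (x∈ zero) (x∈ (suc zero)))) ,
        id ]′ (dichotomy ℱ)

    -- One cross-separated set per family is selected; the hypothesis makes two of them meet.
    colorful-pq₂ : ∀ p q → 2 ≤ q → ColorfulPQTheorem₂ p q
    colorful-pq₂ p q 2≤q with cross-separated-or-pierceable p 1
    ... | N , dichotomy = N , λ ℱ h → [ (λ (φ , _ , across) →
        let T , ∣T∣≡q , x , _ , x∈ = h (λ i → φ i zero)
            i , j , i≢j , i∈T , j∈T = 1<∣p∣⇒distinct T (subst (2 ≤_) (sym ∣T∣≡q) 2≤q)
            K = λ i → member (ℱ i) (φ i zero)
        in ⊥-elim (separated-disjoint (K i) (K j) (across i≢j zero zero) (x∈ i i∈T) (x∈ j j∈T))) ,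
        id ]′ (dichotomy ℱ)

    -- Fractional Helly number

    module Crowd (ℱ : Family) where

      -- An intersecting pair oriented by `meet⇒enters`. The pairs are counted by entering set and
      -- level, recorded in `label`, for which there are `n d` possibilities.
      Entry : Subset (size ℱ) → Set _
      Entry T = ∃ λ a → ∃₂ λ b l → Enters l (member ℱ a) (member ℱ b) × T ≡ ⁅ a ⁆ ∪ ⁅ b ⁆

      entry : ∀ {T} → ∣ T ∣ ≡ 2 × Intersects ℱ T → Entry T
      entry {T} (∣T∣≡2 , (x , l) , x∈P , x∈) with ∣p∣≡2⇒pair T ∣T∣≡2
      ... | a , b , _ , refl with meet⇒enters l {member ℱ a} {member ℱ b}
            ((x , x∈P) , x∈ a (Subset.x∈p∪q⁺ (inj₁ (Subset.x∈⁅x⁆ a))) , x∈ b (Subset.x∈p∪q⁺ {p = ⁅ a ⁆} (inj₂ (Subset.x∈⁅x⁆ b))))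
      ...   | inj₁ ab = a , b , l , ab , refl
      ...   | inj₂ ba = b , a , l , ba , Subset.∪-comm ⁅ a ⁆ ⁅ b ⁆

      label : ∃ Entry → Fin (size ℱ * d)
      label (_ , a , _ , l , _) = combine a l

      target : ∃ Entry → Fin (size ℱ)
      target (_ , _ , b , _) = b

      targets : Fin (size ℱ * d) → List (Fin (size ℱ))
      targets c = let a , l = remQuot {size ℱ} d c in
        filter (all? (λ b → Enters l (member ℱ a) (member ℱ b))) (allFin (size ℱ))

      targets-intersect : ∀ c → Satisfiable ⟦ P ⟧ → Intersects ℱ (fromList (targets c))
      targets-intersect c (p₀ , p₀∈P) = let a , l = remQuot {size ℱ} d c in
        common a l (targets c) λ b∈ → proj₂ (∈-filter⁻ (all? _) {xs = allFin (size ℱ)} b∈)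
        where
        common : ∀ a l bs → (∀ {b} → b ∈ bs → Enters l (member ℱ a) (member ℱ b)) → Intersects ℱ (fromList bs)
        -- When nothing is entered, any point of `P` serves.
        common a l []       _ = p₀ , p₀∈P , λ i i∈ → contradiction i∈ Subset.∉⊥
        common a l (b ∷ bs) h =
          let _ , y , y∈a , _ = h (here refl)
              (x , x∈P) , _ , x∈ = common-point l (member ℱ a) (map (member ℱ) (b ∷ bs)) {y} y∈a λ K∈ →
                let _ , b∈ , K≡ = ∈-map⁻ (member ℱ) K∈ in subst (Enters l (member ℱ a)) (sym K≡) (h b∈)
          in (x , l) , x∈P , λ i i∈ → x∈ (∈-map⁺ (member ℱ) (∈-fromList⁻ (b ∷ bs) i∈))

      target∈ : ∀ {c} e → label e ≡ c → target e ∈ targets c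
      target∈ {c} (_ , a , b , l , enters , _) eq =
        ∈-filter⁺ (all? _) (∈-allFin b)
          (subst (λ (a , l) → Enters l (member ℱ a) (member ℱ b))
            (trans (sym (remQuot-combine a l)) (cong (remQuot {size ℱ} d) eq)) enters)

      same : ∀ e e′ → label e ≡ label e′ → target e ≡ target e′ → proj₁ e ≡ proj₁ e′
      same (_ , a , b , l , _ , refl) (_ , a′ , _ , l′ , _ , refl) eq refl =
        cong (λ a → ⁅ a ⁆ ∪ ⁅ b ⁆) (proj₁ (combine-injective a l a′ l′ eq))

      entries : ∀ {Ts} → Unique Ts → All (λ T → ∣ T ∣ ≡ 2 × Intersects ℱ T) Ts →
        Σ[ es ∈ List (∃ Entry) ] length es ≡ length Ts × AllPairs (λ e e′ → proj₁ e ≢ proj₁ e′) es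
      entries {Ts} unique ts = All.toList es , length-toList es , pairs-distinct unique es
        where
        es = All.map entry ts
        length-toList : ∀ {Ts} (es : All Entry Ts) → length (All.toList es) ≡ length Ts
        length-toList []       = refl
        length-toList (e ∷ es) = cong suc (length-toList es)
        all-distinct : ∀ {T Ts} → All (T ≢_) Ts → (es : All Entry Ts) → All (λ e → T ≢ proj₁ e) (All.toList es)
        all-distinct []       []       = []
        all-distinct (t ∷ ts) (e ∷ es) = t ∷ all-distinct ts es
        pairs-distinct : ∀ {Ts} → Unique Ts → (es : All Entry Ts) → AllPairs (λ e e′ → proj₁ e ≢ proj₁ e′) (All.toList es)
        pairs-distinct []       []       = []
        pairs-distinct (t ∷ ts) (e ∷ es) = all-distinct t es ∷ pairs-distinct ts es

      -- By `same`, label and target determine the pair, so distinct pairs with a common label have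
      -- distinct targets.
      fiber≤targets : ∀ c es → AllPairs (λ e e′ → proj₁ e ≢ proj₁ e′) es →
        length (fiber label c es) ≤ ∣ fromList (targets c) ∣
      fiber≤targets c es distinct = subst (_≤ ∣ fromList (targets c) ∣) (length-map target es′)
        (unique⇒length≤∣p∣ (map target es′)
          (AllPairs.map⁺ (unique es′ (AllPairs.filter⁺ c? distinct) labels))
          (All.map⁺ (All.map (λ {e} eq → ∈-fromList⁺ (target∈ e eq)) labels)))
        where
        c? = all? (λ e → label e ≡ c)
        es′ = fiber label c es
        labels : All (λ e → label e ≡ c) es′
        labels = All.all-filter c? es
        unique : ∀ es → AllPairs (λ e e′ → proj₁ e ≢ proj₁ e′) es → All (λ e → label e ≡ c) es →
          AllPairs (λ e e′ → target e ≢ target e′) es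
        unique []       []       []       = []
        unique (e ∷ es) (r ∷ rs) (l ∷ ls) =
          All.zipWith (λ {e′} (e≢e′ , l′) t≡t′ → e≢e′ (same e e′ (trans l (sym l′)) t≡t′)) (r , ls) ∷ unique es rs ls

      -- Pigeonhole over the labels, taking the one with the most targets. A nonempty `Ts` supplies
      -- a first label and a point of `P`.
      crowded : ∀ {Ts} → Unique Ts → All (λ T → ∣ T ∣ ≡ 2 × Intersects ℱ T) Ts → 0 ℕ.< length Ts →
        ∃ λ T → Intersects ℱ T × length Ts ≤ size ℱ * d * ∣ T ∣
      crowded {T₀ ∷ Ts} unique ts@((_ , x , x∈P , _) ∷ _) _ =
        let es , len , distinct = entries unique ts
            c₀ = label (_ , entry (All.head ts))
            c , _ , c-max = greatest {_R_ = λ c c′ → ∣ fromList (targets c) ∣ ≤ ∣ fromList (targets c′) ∣}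
                              (λ _ _ → ℕ.≤-total _ _) ℕ.≤-trans c₀ (allFin (size ℱ * d))
        in fromList (targets c) , targets-intersect c (x , x∈P) ,
           subst (_≤ size ℱ * d * ∣ fromList (targets c) ∣) len
             (length≤fibers label ∣ fromList (targets c) ∣ es λ c′ →
               ℕ.≤-trans (fiber≤targets c′ es distinct) (All.lookup c-max (there (∈-allFin c′))))

    fractional-helly-upper : 1 ≤ d → FractionalHellyProperty 2
    fractional-helly-upper 1≤d = β , λ α ℱ 2≤n (Ts , unique , ts , many) → conclude α ℱ 2≤n unique ts many
      where
      4d-pos : 0ℚ ℚ.< ι (4 * d)
      4d-pos = ℚ.<-≤-trans (ℚ.positive⁻¹ 1ℚ) (ι-mono-≤ {1} (ℕ.*-mono-≤ {1} {4} (s≤s z≤n) 1≤d))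

      instance
        4d-positive : ℚ.Positive (ι (4 * d))
        4d-positive = ℚ.positive 4d-pos

      -- One of the n d pairs of a set and a level accounts for at least
      -- α C(n,2) / (n d) ≥ α n / (4 d) of the intersecting pairs.
      β : Func UnitInterval UnitInterval
      β = record
        { to   = λ (x , 0<x , x<1) → (ι (4 * d) ÷) x , 0<x÷ (ι (4 * d)) {x} 0<x ,
                   x÷<1 (ι (4 * d)) (ι-mono-≤ {1} (ℕ.*-mono-≤ {1} {4} (s≤s z≤n) 1≤d)) {x} 0<x x<1
        ; cong = λ (x≤y , y≤x) → (λ q∈ → x≤y q∈) , λ q∈ → y≤x q∈
        }

      conclude : ∀ (α : Setoid.Carrier UnitInterval) (ℱ : Family) → 2 ≤ size ℱ → ∀ {Ts} → Unique Ts →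
        All (λ T → ∣ T ∣ ≡ 2 × Intersects ℱ T) Ts →
        (size ℱ C 2) · proj₁ α Defs.≤ fromℕ (length Ts) →
        ∃ λ T → Intersects ℱ T × size ℱ · proj₁ (Func.to β α) Defs.≤ fromℕ ∣ T ∣
      conclude (x , 0<x , x<1) ℱ 2≤n {Ts} unique ts many =
        let T , T-intersects , len≤ = Crowd.crowded ℱ unique ts 0<len
        in T , T-intersects , λ q∈ →
             let r , r∈ , q<nr = ·-lower⁻ _ (size ℱ) q∈ in
             ℚ.<-≤-trans q<nr (fractional-bound 2≤n 1≤d len≤ (n·x≤m⇒n*r≤m {x} (size ℱ C 2) (length Ts) many r∈))
        where
        0<len : 0 ℕ.< length Ts
        -- `4 ≤ n² ≤ 4 C(n,2)` makes the binomial coefficient positive, so `many` rules out an empty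
        -- `Ts`.
        0<len = positive (size ℱ C 2) (length Ts)
          (ℕ.≤-trans (ℕ.*-mono-≤ 2≤n 2≤n) (n²≤4nC2 (size ℱ) 2≤n)) many
          where
          positive : ∀ c m → 4 ≤ 4 * c → c · x Defs.≤ fromℕ m → 0 ℕ.< m
          positive (suc c) zero    _ h = contradiction (λ {q} → h {q}) ([1+n]·x≰0 {x} 0<x c)
          positive (suc c) (suc m) _ _ = s≤s z≤n

    singletons : ∀ n → HasAtLeast n P → Family
    singletons n (f , f∈P , f-inj) = record
      { size     = n
      ; set      = λ i → record { ⟦_⟧ = _∼ f i ; resp = λ {p} {q} p∼q p∼f → ∼-trans {q} {p} {f i} (∼-sym {p} {q} p∼q) p∼f }
      ; convex   = λ i →
          record
          { level  = λ l x → (x , l) ∼ f i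
          ; convex = λ l x≤y y≤z ((_ , f≤x) , l≡) ((z≤f , _) , _) →
                       ((λ q∈ → z≤f (y≤z q∈)) , λ q∈ → x≤y (f≤x q∈)) , l≡
          } ,
          (λ {p} p∼f → p∼f , 𝒫.resp P (∼-sym {p} {f i} p∼f) (f∈P i)) , proj₁
      ; distinct = λ {i} (i⊆j , _) → f-inj (i⊆j {f i} (∼-refl {f i}))
      }

    singletons-disjoint : ∀ n pts {T} → Intersects (singletons n pts) T → ∣ T ∣ ≤ 1
    singletons-disjoint n (f , _ , f-inj) {T} (x , _ , x∈) = ℕ.≮⇒≥ λ 1<∣T∣ →
      let i , j , i≢j , i∈T , j∈T = 1<∣p∣⇒distinct T 1<∣T∣
      in i≢j (f-inj (∼-trans {f i} {x} {f j} (∼-sym {x} {f i} (x∈ i i∈T)) (x∈ j j∈T)))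

    -- For `m ≤ 1` every subfamily of `m` singletons intersects, so the hypothesis holds with
    -- `α = ½`, yet no two of the singletons meet. Infinitely many points allow a family so large
    -- that the fraction `β(½)` of it exceeds one set.
    fractional-helly-lower : Infinite P → ∀ m → FractionalHellyProperty m → 2 ≤ m
    fractional-helly-lower infinite m (β , property) = ℕ.≮⇒≥ λ m<2 →
      let b , 0<b , _ = Func.to β half
          k , kb≰1 = positive-multiple {b} 0<b
          Ts , unique , ts , len = subfamilies m (ℕ.≤-pred m<2) k
          T , T-intersects , h = property half (family k) (ℕ.≤-trans (ℕ.≤-pred m<2) (s≤s z≤n))
            (Ts , unique , ts ,
             subst (λ c → c · proj₁ half Defs.≤ fromℕ (length Ts)) len
               (n·x≤n {proj₁ half} (proj₂ (proj₂ half)) (length Ts)))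
      in kb≰1 λ q∈ → ℚ.<-≤-trans (h q∈)
           (ι-mono-≤ (singletons-disjoint (suc k) (infinite (suc k)) {T} T-intersects))
      where
      family : ∀ k → Family
      family k = singletons (suc k) (infinite (suc k))
      subfamilies : ∀ m → m ≤ 1 → ∀ k → Σ[ Ts ∈ List (Subset (suc k)) ]
        Unique Ts × All (λ T → ∣ T ∣ ≡ m × Intersects (family k) T) Ts × length Ts ≡ suc k C m
      subfamilies zero z≤n k = let f , f∈P , _ = infinite (suc k) in
        Subset.⊥ ∷ [] , [] ∷ [] ,
        (Subset.∣⊥∣≡0 (suc k) , f zero , f∈P zero , λ i i∈ → contradiction i∈ Subset.∉⊥) ∷ [] , refl
      subfamilies (suc zero) (s≤s z≤n) k = let f , f∈P , _ = infinite (suc k) in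
        map ⁅_⁆ (allFin (suc k)) ,
        Unique.map⁺ (λ {i} {j} eq → Subset.x∈⁅y⁆⇒x≡y j (subst (i Subset.∈_) eq (Subset.x∈⁅x⁆ i))) (Unique.allFin⁺ (suc k)) ,
        All.map⁺ (All.universal (λ i → Subset.∣⁅x⁆∣≡1 i , f i , f∈P i , λ j j∈ →
          subst (λ j → f i ∼ f j) (sym (Subset.x∈⁅y⁆⇒x≡y i j∈)) (∼-refl {f i})) (allFin (suc k))) ,
        trans (length-map ⁅_⁆ (allFin (suc k))) (trans (length-tabulate {n = suc k} id) (sym (nC1≡n (suc k))))

theorem5 : (∀ {ℓ} → ExcludedMiddle ℓ) →
    (d : ℕ) → 1 ≤ d → (P : 𝒫 ℝ×[ d ]) →
    let open Convexity ℝ×[ d ] P (𝒞≡ P) in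
    (LeastAtMost RadonProperty (2 * d + 1) ×
    (TwoPointsInEveryLevel P → IsLeast RadonProperty (2 * d + 1))) ×
    (LeastAtMost HellyProperty (2 * d) ×
    (TwoPointsInEveryLevel P → IsLeast HellyProperty (2 * d))) ×
    (LeastAtMost ColorfulHellyProperty (2 * d) ×
    (TwoPointsInEveryLevel P → IsLeast ColorfulHellyProperty (2 * d))) ×
    (FractionalHellyProperty 2 ×
    (Infinite P → IsLeast FractionalHellyProperty 2)) ×
    (∀ p q → 2 ≤ q → q ≤ p → PQTheorem p q) ×
    (∀ p q → 2 ≤ q → q ≤ p → ColorfulPQTheorem₁ p q) ×
    (∀ p q → 2 ≤ q → q ≤ p → ColorfulPQTheorem₂ p q)
theorem5 em d@(suc _) 1≤d P =
  (least {Q = RadonProperty} (2 * d + 1) ℕ.≤-refl radon-upper , λ two → radon-upper , radon-lower two) ,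
  (least {Q = HellyProperty} (2 * d) ℕ.≤-refl helly-upper , λ two → helly-upper , helly-lower two) ,
  (colorful-helly-least , λ two → colorful-helly-upper (nonempty two) , colorful-helly-lower two) ,
  (fractional-helly-upper 1≤d , λ infinite → fractional-helly-upper 1≤d , fractional-helly-lower infinite) ,
  (λ p q 2≤q _ → pq p q 2≤q) ,
  (λ p q 2≤q _ → colorful-pq₁ p q 2≤q) ,
  (λ p q 2≤q _ → colorful-pq₂ p q 2≤q)
  where
  open Convexity ℝ×[ d ] P (𝒞≡ P)
  open Classical em
  open Traces P
  open TwoPoints
  nonempty : TwoPointsInEveryLevel P → Satisfiable ⟦ P ⟧
  nonempty two = let x , _ , _ , x∈P , _ = two zero in (x , zero) , x∈P
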